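{- For every $n\ge1$, we have $|E_n|=2^{e_n}$ and $|B_n|=|B'_n|=2^{b_n}$, where \[ e_n=\frac{2^n}{3}+\begin{cases}2/3 & n\text{ even},\\ 1/3 & n\text{ odd},\end{cases}\qquad b_n=\frac{2^{n+1}}{3}+\frac n2-\begin{cases}2/3 & n\text{ even},\\ 5/6 & n\text{ odd}.\end{cases} \] In particular, $B_n=B'_n$ for every $n\ge1$. Moreover, the closed basilica group $\overline{B}_\infty$ is precisely the kernel of the homomorphism $P:M_\infty\to\mathbb{Z}_2^\times$, $\sigma\mapsto P(\sigma,x_0)$.
   Context: $T_\infty$ is the infinite binary rooted tree whose nodes at level $m\ge0$ are words of length $m$ over $\{a,b\}$ (root $x_0$ = empty word), each $w$ joined to $wa,wb$; $T_n$ the subtree of words of length $\le n$; $\mathrm{Aut}(T_\infty),\mathrm{Aut}(T_n)$ the root-preserving automorphism groups. $\mathrm{Aut}(T_\infty)$ carries the profinite topology whose basic open sets are cosets of $U_m:=\{\sigma:\sigma$ fixes all nodes of length $\le m\}$. $\mathrm{Par}(\sigma,x)=0$ if $\sigma(xa)=\sigma(x)a$ and $\sigma(xb)=\sigma(x)b$, and $=1$ if $\sigma(xa)=\sigma(x)b$ and $\sigma(xb)=\sigma(x)a$; an automorphism is determined by its values $\mathrm{Par}(\sigma,x)$ at all nodes, which may be chosen freely. For $\sigma\in\mathrm{Aut}(T_\infty)$: $Q(\sigma,x):=\sum_{i\ge0}2^i\sum_{s_1,\ldots,s_i\in\{a,b\}}\mathrm{Par}(\sigma,x\,a\,s_1\,a\,s_2\cdots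 a\,s_i)\in\mathbb{Z}_2$ (concatenated words), $P(\sigma,x):=(-1)^{\mathrm{Par}(\sigma,x)}+2\sum_{t\in\{a,b\}}Q(\sigma,xbt)-2\sum_{t\in\{a,b\}}Q(\sigma,xat)\in\mathbb{Z}_2^\times$. For $\tau\in\mathrm{Aut}(T_n)$ and $x$ of length $m\le n$, $P(\tau,x):=P(\tilde\tau,x)\bmod 2^{\lfloor(n-m+1)/2\rfloor}$ for any extension $\tilde\tau$ of $\tau$ to $T_\infty$. $M_\infty:=\{\sigma\in\mathrm{Aut}(T_\infty):P(\sigma,x)=P(\sigma,x_0)\ \forall x\}$ (a group on which $\sigma\mapsto P(\sigma,x_0)$ is a homomorphism). $M_n:=\{\sigma\in\mathrm{Aut}(T_n):$ for all $m\ge0$ and words $x$ of length $m$, $P(\sigma,x)\equiv P(\sigma,x_0)\pmod{2^{\lfloor(n-m+1)/2\rfloor}}\}$. $B'_n:=\{\sigma\in M_n:P(\sigma,x_0)\equiv1\pmod{2^{\lfloor(n+1)/2\rfloor}}\}$, $E_n:=\{\sigma\in B'_n:\sigma$ fixes all nodes of length $\le n-1\}$. Basilica group: $\boldsymbol\alpha,\boldsymbol\beta\in\mathrm{Aut}(T_\infty)$ are defined by $\mathrm{Par}(\boldsymbol\alpha,b^k)=1$ for every even $k\ge0$ (where $b^k$ is the word of $k$ letters $b$; $b^0$ is the root), $\mathrm{Par}(\boldsymbol\beta,b^k)=1$ for every odd $k$, and $\mathrm{Par}(\boldsymbol\alpha,y)=\mathrm{Par}(\boldsymbol\beta,y)=0$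 at all other nodes $y$. $B_\infty:=\langle\boldsymbol\alpha,\boldsymbol\beta\rangle$, $\overline{B}_\infty$ is its closure in $\mathrm{Aut}(T_\infty)$, and $B_n$ is the image of $B_\infty$ under restriction to $T_n$. -}

module Defs where

open import Data.Bool using (Bool; true; false; _xor_; if_then_else_)
open import Data.Nat using (ℕ; zero; suc; _+_; _*_; _∸_; _^_; _≤_; _/_; _%_)
open import Data.Integer as ℤ using (ℤ; +_; -_)
open import Data.Integer.Divisibility using () renaming (_∣_ to _∣ℤ_)
open import Data.List using (List; []; _∷_; _++_; length)
open import Data.List.Membership.Propositional using (_∈_)
open import Data.List.Relation.Unary.Unique.Propositional using (Unique)
open import Data.Product using (Σ; _×_; _,_)
open import Function.Bundles using (_⇔_)
open import Relation.Binary.PropositionalEquality using (_≡_)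

-- Words / nodes of the binary tree: root-first lists, false = a, true = b.

Word : Set
Word = List Bool

-- An automorphism of T_∞ is identified with its parity function
-- x ↦ Par(σ,x) (which determines it and can be chosen freely).
Aut∞ : Set
Aut∞ = Word → Bool

act : Aut∞ → Word → Word
act σ []      = []
act σ (c ∷ w) = (c xor σ []) ∷ act (λ v → σ (c ∷ v)) w

invact : Aut∞ → Word → Word
invact σ []      = []
invact σ (c ∷ w) = (c xor σ []) ∷ invact (λ v → σ ((c xor σ []) ∷ v)) w

-- Group operations (in terms of parities):  (σ ∘ τ)(x) = σ(τ(x)).
idA : Aut∞
idA _ = false

_∘A_ : Aut∞ → Aut∞ → Aut∞
(σ ∘A τ) x = τ x xor σ (act τ x)

invA : Aut∞ → Aut∞
invA σ x = σ (invact σ x)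

-- Basilica generators: α has parity 1 exactly at b^k, k even;
-- β exactly at b^k, k odd.
mutual
  αP : Aut∞
  αP []          = true
  αP (true ∷ w)  = βP w
  αP (false ∷ w) = false

  βP : Aut∞
  βP []          = false
  βP (true ∷ w)  = αP w
  βP (false ∷ w) = false

data Gen : Set where
  gα gβ : Gen

genA : Gen → Aut∞
genA gα = αP
genA gβ = βP

GWord : Set
GWord = List (Gen × Bool)

letterA : Gen × Bool → Aut∞
letterA (g , false) = genA g
letterA (g , true)  = invA (genA g)

eval : GWord → Aut∞
eval []      = idA
eval (l ∷ w) = letterA l ∘A eval w

-- σ lies in the closure of B_∞ = ⟨α,β⟩: every basic neighbourhood σU_m
-- meets B_∞, i.e. some element of B_∞ agrees with σ on all nodes of length ≤ m.
InClosureB : Aut∞ → Set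
InClosureB σ = ∀ (m : ℕ) → Σ GWord λ w → ∀ (x : Word) → length x ≤ m → act (eval w) x ≡ act σ x

-- Automorphisms of T_n: parities at the nodes of length < n,
-- stored as a complete labelled binary tree of depth n.

data Lab : ℕ → Set where
  leaf : Lab zero
  node : ∀ {n} → Bool → Lab n → Lab n → Lab (suc n)

restrict : Aut∞ → (n : ℕ) → Lab n
restrict σ zero    = leaf
restrict σ (suc n) = node (σ []) (restrict (λ v → σ (false ∷ v)) n) (restrict (λ v → σ (true ∷ v)) n)

ext : ∀ {n} → Lab n → Aut∞
ext leaf         _           = false
ext (node p l r) []          = p
ext (node p l r) (false ∷ w) = ext l w
ext (node p l r) (true ∷ w)  = ext r w

InBn : (n : ℕ) → Lab n → Set
InBn n τ = Σ GWord λ w → restrict (eval w) n ≡ τ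

-- The 2-adic quantities Q, P, computed modulo 2^k.

bit : Bool → ℕ
bit false = 0
bit true  = 1

-- S σ x i = Σ_{s_1..s_i} Par(σ, x a s_1 a s_2 ... a s_i)
S : Aut∞ → Word → ℕ → ℕ
S σ x zero    = bit (σ x)
S σ x (suc i) = S σ (x ++ false ∷ false ∷ []) i + S σ (x ++ false ∷ true ∷ []) i

-- Qt σ x k = Σ_{i<k} 2^i S σ x i  ≡  Q(σ,x)  (mod 2^k)
Qt : Aut∞ → Word → ℕ → ℕ
Qt σ x zero    = 0
Qt σ x (suc k) = Qt σ x k + 2 ^ k * S σ x k

sgn : Bool → ℤ
sgn false = + 1
sgn true  = - (+ 1)

-- Pt σ x k ≡ P(σ,x)  (mod 2^k)
Pt : Aut∞ → Word → ℕ → ℤ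
Pt σ x k =
  (sgn (σ x) ℤ.+ (+ 2) ℤ.* (+ (Qt σ (x ++ true ∷ false ∷ []) k + Qt σ (x ++ true ∷ true ∷ []) k)))
  ℤ.- (+ 2) ℤ.* (+ (Qt σ (x ++ false ∷ false ∷ []) k + Qt σ (x ++ false ∷ true ∷ []) k))

_≡_[mod2^_] : ℤ → ℤ → ℕ → Set
a ≡ b [mod2^ k ] = (+ (2 ^ k)) ∣ℤ (a ℤ.- b)

-- M_∞ : P(σ,x) = P(σ,x₀) in ℤ₂ for all x (equality in ℤ₂ = equality mod 2^k for all k)
InM∞ : Aut∞ → Set
InM∞ σ = ∀ (x : Word) (k : ℕ) → Pt σ x k ≡ Pt σ [] k [mod2^ k ]

InKerP : Aut∞ → Set
InKerP σ = InM∞ σ × (∀ (k : ℕ) → Pt σ [] k ≡ + 1 [mod2^ k ])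

prec : ℕ → ℕ → ℕ
prec n m = (n + 1 ∸ m) / 2

InMn : (n : ℕ) → Lab n → Set
InMn n τ = ∀ (x : Word) → length x ≤ n →
  Pt (ext τ) x (prec n (length x)) ≡ Pt (ext τ) [] (prec n (length x)) [mod2^ prec n (length x) ]

InB'n : (n : ℕ) → Lab n → Set
InB'n n τ = InMn n τ × (Pt (ext τ) [] (prec n 0) ≡ + 1 [mod2^ prec n 0 ])

InEn : (n : ℕ) → Lab n → Set
InEn n τ = InB'n n τ × (∀ (x : Word) → length x ≤ n ∸ 1 → act (ext τ) x ≡ x)

HasCard : ∀ {n} → (Lab n → Set) → ℕ → Set
HasCard {n} P k = Σ (List (Lab n)) λ l → Unique l × (∀ τ → (τ ∈ l) ⇔ P τ) × (length l ≡ k)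

-- exponents: e_n = (2^n + 2)/3 (n even), (2^n+1)/3 (n odd);
-- b_n = (2^{n+2} + 3n - 4)/6 (n even), (2^{n+2} + 3n - 5)/6 (n odd).
eExp : ℕ → ℕ
eExp n = (2 ^ n + (2 ∸ n % 2)) / 3

bExp : ℕ → ℕ
bExp n = (2 ^ (n + 2) + 3 * n ∸ (4 + n % 2)) / 6

{-# OPTIONS --safe #-}

-- Write α = (1, β)·swap and β = (1, α) for the generators.  The exponent sums
-- of α and β in a word are visible in the labels of the tree: an automorphism
-- with root label p and sections l, r has α-degree p + 2 deg_β l and β-degree
-- deg_α l + deg_α r, and unfolding this recursion gives Q(σ,x) as the α-degree
-- of the section of σ at x.  Since (-1)^p = 1 − 2p, the condition P(σ,x) = 1
-- says exactly that deg_β r = deg_β l + p at the node x.  Automorphisms with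
-- this property at every node (Good) are closed under products, on them
-- both degrees are additive, and α^{±1}, β^{±1} have it; so B_n ⊆ B'_n.
-- Conversely (α, 1), (1, α) and (β, β) lie in the basilica group, so a pair
-- of elements of B_n with the same β-degree comes from B_{n+1}, and B'_n ⊆ B_n
-- follows by induction.  For the orders, the extensions of an element of B'_n
-- to B'_{n+1} with a prescribed new binary digit of the degree are counted by
-- a recursion that does not depend on the element; E_{n+1} is the set of
-- extensions of the identity.

module Submission where

open import Defs
open import Data.Bool using (Bool; true; false; _xor_; not)
open import Data.Bool.Properties using (xor-identityʳ)
open import Data.Empty using (⊥)
open import Data.Integer using (ℤ; +_; -[1+_]; -_; _+_; _*_; _-_; ∣_∣)
open import Data.Integer.Divisibility.Signed using (divides; ∣ᵤ⇒∣; ∣⇒∣ᵤ)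
open import Data.Integer.Properties using (pos-*; abs-*; *-cancelˡ-≡)
open import Data.Integer.Tactic.RingSolver using (solve-∀)
open import Data.List using ([]; _∷_; _++_; length; map; cartesianProductWith)
open import Data.List.Membership.Propositional using (_∈_)
open import Data.List.Membership.Propositional.Properties
  using (∈-++⁺ˡ; ∈-++⁺ʳ; ∈-++⁻; ∈-cartesianProductWith⁺; ∈-cartesianProductWith⁻)
open import Data.List.Properties using (length-++; length-map; ∷-injectiveˡ; ∷-injectiveʳ)
open import Data.List.Relation.Unary.All as All using ([]; _∷_)
open import Data.List.Relation.Unary.AllPairs using ([]; _∷_)
open import Data.List.Relation.Unary.Any using (here; there)
open import Data.List.Relation.Unary.Unique.Propositional using (Unique)
open import Data.List.Relation.Unary.Unique.Propositional.Properties
  using (++⁺; cartesianProductWith⁺)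
open import Data.Nat as ℕ
  using (ℕ; zero; suc; _≤_; z≤n; s≤s; _^_; _∸_; _%_; _/_; ⌊_/2⌋; ⌈_/2⌉)
open import Data.Nat.Divisibility using (∣-refl)
open import Data.Nat.DivMod using (m*n/n≡m; /-monoˡ-≤; +-distrib-/-∣ˡ)
import Data.Nat.Properties as ℕP
import Data.Nat.Tactic.RingSolver as ℕ-Solver
open import Data.Product using (∃; ∃₂; _×_; _,_; proj₂)
open import Data.Sum using (_⊎_; inj₁; inj₂)
open import Data.Unit using (⊤; tt)
open import Function.Bundles using (_⇔_; mk⇔; Equivalence)
open import Function.Properties.Equivalence using () renaming (sym to ⇔-sym; trans to ⇔-trans)
open import Relation.Binary.PropositionalEquality
  using (_≡_; refl; sym; trans; cong; cong₂; subst; module ≡-Reasoning)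
open import Relation.Nullary using (contradiction)

open Equivalence using (to; from)

-- Congruences of integers

infix 4 _≈_[_]
infix 3 _by_

-- The quotient is kept as data: matching on `refl` replaces the left side by an explicit linear
-- expression, and the remaining identity is left to the ring solver.
record _≈_[_] (a b : ℤ) (m : ℕ) : Set where
  constructor _by_
  field
    quotient : ℤ
    equality : a ≡ b + quotient * + m

≈-refl : ∀ {a m} → a ≈ a [ m ]
≈-refl {a} {m} = (+ 0) by lemma a (+ m)
  where
  lemma : ∀ a m → a ≡ a + + 0 * m
  lemma = solve-∀

≈-reflexive : ∀ {a b m} → a ≡ b → a ≈ b [ m ]
≈-reflexive refl = ≈-refl

≈-sym : ∀ {a b m} → a ≈ b [ m ] → b ≈ a [ m ]
≈-sym {b = b} {m} (c by refl) = (- c) by lemma b c (+ m)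
  where
  lemma : ∀ b c m → b ≡ (b + c * m) + - c * m
  lemma = solve-∀

≈-trans : ∀ {a b c m} → a ≈ b [ m ] → b ≈ c [ m ] → a ≈ c [ m ]
≈-trans {c = z} {m} (c by refl) (d by refl) = (c + d) by lemma z c d (+ m)
  where
  lemma : ∀ z c d m → (z + d * m) + c * m ≡ z + (c + d) * m
  lemma = solve-∀

≈-+ : ∀ {a b c d m} → a ≈ b [ m ] → c ≈ d [ m ] → a + c ≈ b + d [ m ]
≈-+ {b = b} {d = d} {m} (x by refl) (y by refl) = (x + y) by lemma b d x y (+ m)
  where
  lemma : ∀ b d x y m → (b + x * m) + (d + y * m) ≡ (b + d) + (x + y) * m
  lemma = solve-∀

≈-double : ∀ {a b m} → a ≈ b [ m ] → + 2 * a ≈ + 2 * b [ 2 ℕ.* m ]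
≈-double {b = b} {m} (c by refl) = c by trans (lemma b c (+ m))
    (cong (λ z → + 2 * b + c * z) (sym (pos-* 2 m)))
  where
  lemma : ∀ b c m → + 2 * (b + c * m) ≡ + 2 * b + c * (+ 2 * m)
  lemma = solve-∀

-- Automorphisms of the finite trees and their degrees

child : ∀ {n} → Lab n → Lab n → Bool → Lab n
child l r false = l
child l r true  = r

mul : ∀ {n} → Lab n → Lab n → Lab n
mul leaf leaf = leaf
mul (node p l r) (node q l′ r′) =
  node (q xor p) (mul (child l r (false xor q)) l′) (mul (child l r (true xor q)) r′)

one : ∀ n → Lab n
one = restrict idA

mul-identityˡ : ∀ {n} (τ : Lab n) → mul (one n) τ ≡ τ
mul-identityˡ leaf = refl
mul-identityˡ (node false l r) = cong₂ (node false) (mul-identityˡ l) (mul-identityˡ r)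
mul-identityˡ (node true  l r) = cong₂ (node true) (mul-identityˡ l) (mul-identityˡ r)

mul-identityʳ : ∀ {n} (τ : Lab n) → mul τ (one n) ≡ τ
mul-identityʳ leaf = refl
mul-identityʳ (node p l r) = cong₂ (node p) (mul-identityʳ l) (mul-identityʳ r)

mul-assoc : ∀ {n} (ρ σ τ : Lab n) → mul (mul ρ σ) τ ≡ mul ρ (mul σ τ)
mul-assoc leaf leaf leaf = refl
mul-assoc (node p l r) (node false l₁ r₁) (node false l₂ r₂) =
  cong₂ (node p) (mul-assoc l l₁ l₂) (mul-assoc r r₁ r₂)
mul-assoc (node p l r) (node false l₁ r₁) (node true l₂ r₂) =
  cong₂ (node (not p)) (mul-assoc r r₁ l₂) (mul-assoc l l₁ r₂)
mul-assoc (node p l r) (node true l₁ r₁) (node false l₂ r₂) =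
  cong₂ (node (not p)) (mul-assoc r l₁ l₂) (mul-assoc l r₁ r₂)
mul-assoc (node false l r) (node true l₁ r₁) (node true l₂ r₂) =
  cong₂ (node false) (mul-assoc l r₁ l₂) (mul-assoc r l₁ r₂)
mul-assoc (node true l r) (node true l₁ r₁) (node true l₂ r₂) =
  cong₂ (node true) (mul-assoc l r₁ l₂) (mul-assoc r l₁ r₂)

restrict-child : ∀ (σ : Aut∞) n b →
  restrict (λ v → σ (b ∷ v)) n
    ≡ child (restrict (λ v → σ (false ∷ v)) n) (restrict (λ v → σ (true ∷ v)) n) b
restrict-child σ n false = refl
restrict-child σ n true  = refl

restrict-∘A : ∀ (σ τ : Aut∞) n → restrict (σ ∘A τ) n ≡ mul (restrict σ n) (restrict τ n)
restrict-∘A σ τ zero    = refl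
restrict-∘A σ τ (suc n) = cong₂ (node (τ [] xor σ [])) (half false) (half true)
  where
  half : ∀ c → restrict (λ v → (σ ∘A τ) (c ∷ v)) n
    ≡ mul (child (restrict (λ v → σ (false ∷ v)) n) (restrict (λ v → σ (true ∷ v)) n) (c xor τ []))
          (restrict (λ v → τ (c ∷ v)) n)
  half c = trans (restrict-∘A (λ v → σ ((c xor τ []) ∷ v)) (λ v → τ (c ∷ v)) n)
    (cong (λ ρ → mul ρ (restrict (λ v → τ (c ∷ v)) n)) (restrict-child σ n (c xor τ [])))

-- On T_n the degrees are meaningful only modulo the orders modA n and modB n
-- of the restrictions of α and β.
mutual
  degA : ∀ {n} → Lab n → ℤ
  degA leaf         = + 0
  degA (node p l r) = + bit p + + 2 * degB l

  degB : ∀ {n} → Lab n → ℤ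
  degB leaf         = + 0
  degB (node p l r) = degA l + degA r

mutual
  modA : ℕ → ℕ
  modA zero    = 1
  modA (suc n) = 2 ℕ.* modB n

  modB : ℕ → ℕ
  modB zero    = 1
  modB (suc n) = modA n

-- This is P ≡ 1 at every node. At a node above two trees of depth `n`, P is prescribed modulo
-- `2 * modB n`; dividing P - 1 by 2 leaves the modulus `modB n`.
Good : ∀ {n} → Lab n → Set
Good leaf             = ⊤
Good {suc n} (node p l r) = Good l × Good r × degB r ≈ degB l + + bit p [ modB n ]

bit-not : ∀ p → + bit (not p) ≡ + 1 - + bit p
bit-not false = refl
bit-not true  = refl

mutual
  -- The three statements form one induction. The root condition of a product compares `degB` of
  -- products of sections, `degB` in turn needs `degA` one level down, and `degA` of a product sees
  -- the right section of `σ` when `τ` swaps, so it needs the root condition of `σ`.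
  Good-mul : ∀ {n} {σ τ : Lab n} → Good σ → Good τ → Good (mul σ τ)
  Good-mul {σ = leaf} {leaf} _ _ = tt
  Good-mul {suc n} {node p l r} {node false l′ r′} (gl , gr , e) (gl′ , gr′ , e′) =
    Good-mul gl gl′ , Good-mul gr gr′ ,
    ≈-trans (degB-mul gr gr′) (≈-trans (≈-+ e e′)
      (≈-trans (≈-reflexive (lemma (degB l) (degB l′) (+ bit p)))
        (≈-+ (≈-sym (degB-mul gl gl′)) ≈-refl)))
    where
    lemma : ∀ x x′ p → (x + p) + (x′ + + 0) ≡ (x + x′) + p
    lemma = solve-∀
  -- The swap in `τ` exchanges `l` and `r`, so the `p` gained from `e` combines with the new root
  -- label 1 - p to give 1, the root label of `τ`.
  Good-mul {suc n} {node p l r} {node true l′ r′} (gl , gr , e) (gl′ , gr′ , e′) =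
    Good-mul gr gl′ , Good-mul gl gr′ ,
    ≈-trans (degB-mul gl gr′) (≈-trans (≈-+ (≈-refl {degB l}) e′)
      (≈-trans (≈-reflexive (trans (lemma (degB l) (degB l′) (+ bit p))
                 (cong (λ z → ((degB l + + bit p) + degB l′) + z) (sym (bit-not p)))))
        (≈-+ (≈-trans (≈-+ (≈-sym e) ≈-refl) (≈-sym (degB-mul gr gl′))) ≈-refl)))
    where
    lemma : ∀ x x′ p → x + (x′ + + 1) ≡ ((x + p) + x′) + (+ 1 - p)
    lemma = solve-∀

  degA-mul : ∀ {n} {σ τ : Lab n} → Good σ → Good τ →
             degA (mul σ τ) ≈ degA σ + degA τ [ modA n ]
  degA-mul {σ = leaf} {leaf} _ _ = ≈-refl
  degA-mul {suc n} {node p l r} {node false l′ r′} (gl , gr , e) (gl′ , gr′ , e′) =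
    ≈-trans (≈-+ (≈-refl {+ bit p}) (≈-double (degB-mul gl gl′)))
      (≈-reflexive (lemma (+ bit p) (degB l) (degB l′)))
    where
    lemma : ∀ p x x′ → p + + 2 * (x + x′) ≡ (p + + 2 * x) + (+ 0 + + 2 * x′)
    lemma = solve-∀
  degA-mul {suc n} {node p l r} {node true l′ r′} (gl , gr , e) (gl′ , gr′ , e′) =
    -- The congruence `e` holds modulo `modB n`; the factor 2 in `degA` raises it to the modulus
    -- `modA (suc n)`.
    ≈-trans (≈-+ (≈-reflexive (bit-not p))
              (≈-double (≈-trans (degB-mul gr gl′) (≈-+ e ≈-refl))))
      (≈-reflexive (lemma (+ bit p) (degB l) (degB l′)))
    where
    lemma : ∀ p x x′ → (+ 1 - p) + + 2 * ((x + p) + x′) ≡ (p + + 2 * x) + (+ 1 + + 2 * x′)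
    lemma = solve-∀

  degB-mul : ∀ {n} {σ τ : Lab n} → Good σ → Good τ →
             degB (mul σ τ) ≈ degB σ + degB τ [ modB n ]
  degB-mul {σ = leaf} {leaf} _ _ = ≈-refl
  degB-mul {suc n} {node p l r} {node false l′ r′} (gl , gr , e) (gl′ , gr′ , e′) =
    ≈-trans (≈-+ (degA-mul gl gl′) (degA-mul gr gr′))
      (≈-reflexive (lemma (degA l) (degA l′) (degA r) (degA r′)))
    where
    lemma : ∀ x x′ y y′ → (x + x′) + (y + y′) ≡ (x + y) + (x′ + y′)
    lemma = solve-∀
  degB-mul {suc n} {node p l r} {node true l′ r′} (gl , gr , e) (gl′ , gr′ , e′) =
    ≈-trans (≈-+ (degA-mul gr gl′) (degA-mul gl gr′))
      (≈-reflexive (lemma (degA l) (degA l′) (degA r) (degA r′)))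
    where
    lemma : ∀ x x′ y y′ → (y + x′) + (x + y′) ≡ (x + y) + (x′ + y′)
    lemma = solve-∀

-- Degrees of the identity, the generators and their inverses

degA-one : ∀ n → degA (one n) ≡ + 0
degB-one : ∀ n → degB (one n) ≡ + 0
degA-one zero    = refl
degA-one (suc n) = cong (λ z → + 0 + + 2 * z) (degB-one n)
degB-one zero    = refl
degB-one (suc n) = cong₂ _+_ (degA-one n) (degA-one n)

Good-one : ∀ n → Good (one n)
Good-one zero    = tt
Good-one (suc n) = Good-one n , Good-one n ,
  ≈-reflexive (trans (degB-one n) (sym (cong (_+ + 0) (degB-one n))))

degA-αP : ∀ n → degA (restrict αP n) ≈ + 1 [ modA n ]
degA-αP zero    = (- + 1) by refl
degA-αP (suc n) = ≈-reflexive (cong (λ z → + 1 + + 2 * z) (degB-one n))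

degB-βP : ∀ n → degB (restrict βP n) ≈ + 1 [ modB n ]
degB-βP zero    = (- + 1) by refl
degB-βP (suc n) = ≈-+ (≈-reflexive (degA-one n)) (degA-αP n)

-- The inverse of α = (1, β)·swap has left section β⁻¹ and right section 1, so its α-degree is 1 +
-- 2(-1). The inverse of β is (1, α⁻¹).
degA-α⁻ : ∀ n → degA (restrict (invA αP) n) ≈ - + 1 [ modA n ]
degB-β⁻ : ∀ n → degB (restrict (invA βP) n) ≈ - + 1 [ modB n ]
degA-α⁻ zero    = (+ 1) by refl
degA-α⁻ (suc n) = ≈-+ (≈-refl {+ 1}) (≈-double (degB-β⁻ n))
degB-β⁻ zero    = (+ 1) by refl
degB-β⁻ (suc n) = ≈-+ (≈-reflexive (degA-one n)) (degA-α⁻ n)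

Good-αP : ∀ n → Good (restrict αP n)
Good-βP : ∀ n → Good (restrict βP n)
degB-αP : ∀ n → degB (restrict αP n) ≈ + 0 [ modB n ]
degA-βP : ∀ n → degA (restrict βP n) ≈ + 0 [ modA n ]
Good-αP zero    = tt
Good-αP (suc n) = Good-one n , Good-βP n ,
  ≈-trans (degB-βP n) (≈-reflexive (sym (cong (_+ + 1) (degB-one n))))
Good-βP zero    = tt
Good-βP (suc n) = Good-one n , Good-αP n ,
  ≈-trans (degB-αP n) (≈-reflexive (sym (cong (_+ + 0) (degB-one n))))
degB-αP zero    = ≈-refl
degB-αP (suc n) = ≈-+ (≈-reflexive (degA-one n)) (degA-βP n)
degA-βP zero    = ≈-refl
degA-βP (suc n) = ≈-reflexive (cong (λ z → + 0 + + 2 * z) (degB-one n))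

Good-α⁻ : ∀ n → Good (restrict (invA αP) n)
Good-β⁻ : ∀ n → Good (restrict (invA βP) n)
degB-α⁻ : ∀ n → degB (restrict (invA αP) n) ≈ + 0 [ modB n ]
degA-β⁻ : ∀ n → degA (restrict (invA βP) n) ≈ + 0 [ modA n ]
Good-α⁻ zero    = tt
Good-α⁻ (suc n) = Good-β⁻ n , Good-one n ,
  ≈-trans (≈-reflexive (degB-one n)) (≈-sym (≈-+ (degB-β⁻ n) ≈-refl))
Good-β⁻ zero    = tt
Good-β⁻ (suc n) = Good-one n , Good-α⁻ n ,
  ≈-trans (degB-α⁻ n) (≈-reflexive (sym (cong (_+ + 0) (degB-one n))))
degB-α⁻ zero    = ≈-refl
degB-α⁻ (suc n) = ≈-+ (degA-β⁻ n) (≈-reflexive (degA-one n))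
degA-β⁻ zero    = ≈-refl
degA-β⁻ (suc n) = ≈-reflexive (cong (λ z → + 0 + + 2 * z) (degB-one n))

Good-eval : ∀ w n → Good (restrict (eval w) n)
Good-eval []      n = Good-one n
Good-eval (l ∷ w) n =
  subst Good (sym (restrict-∘A (letterA l) (eval w) n)) (Good-mul (Good-letter l) (Good-eval w n))
  where
  Good-letter : ∀ l → Good (restrict (letterA l) n)
  Good-letter (gα , false) = Good-αP n
  Good-letter (gα , true)  = Good-α⁻ n
  Good-letter (gβ , false) = Good-βP n
  Good-letter (gβ , true)  = Good-β⁻ n

InBn⇒Good : ∀ {n} {τ : Lab n} → InBn n τ → Good τ
InBn⇒Good {n} (w , refl) = Good-eval w n

-- Generation by α and β

pow : ∀ {n} → Lab n → ℕ → Lab n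
pow {n} τ zero = one n
pow τ (suc k)  = mul τ (pow τ k)

pow-+ : ∀ {n} (τ : Lab n) i j → pow τ (i ℕ.+ j) ≡ mul (pow τ i) (pow τ j)
pow-+ τ zero    j = sym (mul-identityˡ (pow τ j))
pow-+ τ (suc i) j = trans (cong (mul τ) (pow-+ τ i j)) (sym (mul-assoc τ (pow τ i) (pow τ j)))

pow-one : ∀ n k → pow (one n) k ≡ one n
pow-one n zero    = refl
pow-one n (suc k) = trans (mul-identityˡ (pow (one n) k)) (pow-one n k)

pow-node : ∀ {n} (l r : Lab n) k → pow (node false l r) k ≡ node false (pow l k) (pow r k)
pow-node l r zero    = refl
pow-node l r (suc k) = cong (mul (node false l r)) (pow-node l r k)

pow-double : ∀ {n} (τ : Lab n) k → pow τ (k ℕ.* 2) ≡ pow (mul τ τ) k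
pow-double τ zero    = refl
pow-double τ (suc k) = trans (cong (λ σ → mul τ (mul τ σ)) (pow-double τ k))
  (sym (mul-assoc τ τ (pow (mul τ τ) k)))

α β : ∀ n → Lab n
α = restrict αP
β = restrict βP

α² : ∀ n → mul (α (suc n)) (α (suc n)) ≡ node false (β n) (β n)
α² n = cong₂ (node false) (mul-identityʳ (β n)) (mul-identityˡ (β n))

mutual
  -- Since α² = (β, β) and β = (1, α), the order of α doubles that of β one level down, while β
  -- inherits the order of α. Arbitrary multiples `c` of the order pass through the induction
  -- unchanged.
  pow-α-modA : ∀ n c → pow (α n) (c ℕ.* modA n) ≡ one n
  pow-α-modA zero    c with pow (α 0) (c ℕ.* 1)
  ... | leaf = refl
  pow-α-modA (suc n) c = begin
    pow (α (suc n)) (c ℕ.* (2 ℕ.* modB n))      ≡⟨ cong (pow (α (suc n))) exponent ⟩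
    pow (α (suc n)) (c ℕ.* modB n ℕ.* 2)        ≡⟨ pow-double (α (suc n)) (c ℕ.* modB n) ⟩
    pow (mul (α (suc n)) (α (suc n))) (c ℕ.* modB n)
      ≡⟨ cong (λ τ → pow τ (c ℕ.* modB n)) (α² n) ⟩
    pow (node false (β n) (β n)) (c ℕ.* modB n) ≡⟨ pow-node (β n) (β n) (c ℕ.* modB n) ⟩
    node false (pow (β n) (c ℕ.* modB n)) (pow (β n) (c ℕ.* modB n))
      ≡⟨ cong₂ (node false) (pow-β-modB n c) (pow-β-modB n c) ⟩
    one (suc n) ∎
    where
    open ≡-Reasoning
    exponent : c ℕ.* (2 ℕ.* modB n) ≡ c ℕ.* modB n ℕ.* 2
    exponent = trans (cong (c ℕ.*_) (ℕP.*-comm 2 (modB n))) (sym (ℕP.*-assoc c (modB n) 2))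

  pow-β-modB : ∀ n c → pow (β n) (c ℕ.* modB n) ≡ one n
  pow-β-modB zero    c with pow (β 0) (c ℕ.* 1)
  ... | leaf = refl
  pow-β-modB (suc n) c = trans (pow-node (one n) (α n) (c ℕ.* modA n))
    (cong₂ (node false) (pow-one n (c ℕ.* modA n)) (pow-α-modA n c))

mutual
  -- Writing `modB n` as `suc k` exhibits β⁻¹ as the positive power β^k. The same form supplies the
  -- nonzero modulus in `lift-≈`.
  modA-suc : ∀ n → ∃ λ k → modA n ≡ suc k
  modA-suc zero    = 0 , refl
  modA-suc (suc n) with k , eq ← modB-suc n rewrite eq = _ , refl

  modB-suc : ∀ n → ∃ λ k → modB n ≡ suc k
  modB-suc zero    = 0 , refl
  modB-suc (suc n) = modA-suc n

-- Positive words suffice, since α and β have finite order on T_n.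
data Pos {n : ℕ} : Lab n → Set where
  pos-one : Pos (one n)
  pos-α   : ∀ {τ} → Pos τ → Pos (mul (α n) τ)
  pos-β   : ∀ {τ} → Pos τ → Pos (mul (β n) τ)

Pos⇒InBn : ∀ {n} {τ : Lab n} → Pos τ → InBn n τ
Pos⇒InBn pos-one = [] , refl
Pos⇒InBn {n} (pos-α p) with w , eq ← Pos⇒InBn p =
  ((gα , false) ∷ w) , trans (restrict-∘A αP (eval w) n) (cong (mul (α n)) eq)
Pos⇒InBn {n} (pos-β p) with w , eq ← Pos⇒InBn p =
  ((gβ , false) ∷ w) , trans (restrict-∘A βP (eval w) n) (cong (mul (β n)) eq)

Pos⇒Good : ∀ {n} {τ : Lab n} → Pos τ → Good τ
Pos⇒Good p = InBn⇒Good (Pos⇒InBn p)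

Pos-mul : ∀ {n} {σ τ : Lab n} → Pos σ → Pos τ → Pos (mul σ τ)
Pos-mul {τ = τ} pos-one q = subst Pos (sym (mul-identityˡ τ)) q
Pos-mul {n} {τ = τ} (pos-α {σ} p) q = subst Pos (sym (mul-assoc (α n) σ τ)) (pos-α (Pos-mul p q))
Pos-mul {n} {τ = τ} (pos-β {σ} p) q = subst Pos (sym (mul-assoc (β n) σ τ)) (pos-β (Pos-mul p q))

Pos-pow : ∀ {n} {τ : Lab n} k → Pos τ → Pos (pow τ k)
Pos-pow zero    p = pos-one
Pos-pow (suc k) p = Pos-mul p (Pos-pow k p)

Pos-α : ∀ n → Pos (α n)
Pos-α n = subst Pos (mul-identityʳ (α n)) (pos-α pos-one)

Pos-β : ∀ n → Pos (β n)
Pos-β n = subst Pos (mul-identityʳ (β n)) (pos-β pos-one)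

-- Pairs of elements of the group one level down

Pos-ββ : ∀ n → Pos (node false (β n) (β n))
Pos-ββ n = subst Pos (α² n) (Pos-mul (Pos-α (suc n)) (Pos-α (suc n)))

Pos-ββ-pow : ∀ n k → Pos (node false (pow (β n) k) (pow (β n) k))
Pos-ββ-pow n k = subst Pos (pow-node (β n) (β n) k) (Pos-pow k (Pos-ββ n))

pow-β-inverseˡ : ∀ n k → modB n ≡ suc k → mul (pow (β n) k) (β n) ≡ one n
pow-β-inverseˡ n k eq = begin
  mul (pow (β n) k) (β n)          ≡⟨ cong (mul (pow (β n) k)) (mul-identityʳ (β n)) ⟨
  mul (pow (β n) k) (pow (β n) 1)  ≡⟨ pow-+ (β n) k 1 ⟨
  pow (β n) (k ℕ.+ 1)              ≡⟨ cong (pow (β n)) exponent ⟩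
  pow (β n) (1 ℕ.* modB n)         ≡⟨ pow-β-modB n 1 ⟩
  one n                            ∎
  where
  open ≡-Reasoning
  exponent : k ℕ.+ 1 ≡ 1 ℕ.* modB n
  exponent = trans (ℕP.+-comm k 1) (trans (sym eq) (sym (ℕP.*-identityˡ (modB n))))

pow-β-inverseʳ : ∀ n k → modB n ≡ suc k → mul (β n) (pow (β n) k) ≡ one n
pow-β-inverseʳ n k eq = trans (cong (pow (β n)) (trans (sym eq) (sym (ℕP.*-identityˡ (modB n)))))
  (pow-β-modB n 1)

-- (α, 1) = (β⁻¹, β⁻¹)·αβα, since αβα = (βα, β).
Pos-α1 : ∀ n → Pos (node false (α n) (one n))
Pos-α1 n with k , eq ← modB-suc n =
  subst Pos (cong₂ (node false) left right)
    (Pos-mul (Pos-ββ-pow n k) (Pos-mul (Pos-α (suc n)) (Pos-mul (Pos-β (suc n)) (Pos-α (suc n)))))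
  where
  open ≡-Reasoning
  B = pow (β n) k
  left : mul B (mul (β n) (mul (α n) (one n))) ≡ α n
  left = begin
    mul B (mul (β n) (mul (α n) (one n))) ≡⟨ cong (λ z → mul B (mul (β n) z)) (mul-identityʳ (α n)) ⟩
    mul B (mul (β n) (α n))               ≡⟨ mul-assoc B (β n) (α n) ⟨
    mul (mul B (β n)) (α n)               ≡⟨ cong (λ z → mul z (α n)) (pow-β-inverseˡ n k eq) ⟩
    mul (one n) (α n)                     ≡⟨ mul-identityˡ (α n) ⟩
    α n                                   ∎
  right : mul B (mul (one n) (mul (one n) (β n))) ≡ one n
  right = begin
    mul B (mul (one n) (mul (one n) (β n))) ≡⟨ cong (mul B) (mul-identityˡ _) ⟩
    mul B (mul (one n) (β n))               ≡⟨ cong (mul B) (mul-identityˡ (β n)) ⟩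
    mul B (β n)                             ≡⟨ pow-β-inverseˡ n k eq ⟩
    one n                                   ∎

-- The word for `τ` is copied letter by letter, α becoming (α, 1) and β becoming (β, β); only the
-- β's leave a trace on the right. The mirror version below uses (1, α), which is β itself.
Pos-extendˡ : ∀ {n} {τ : Lab n} → Pos τ → ∃ λ i → Pos (node false τ (pow (β n) i))
Pos-extendˡ pos-one = 0 , pos-one
Pos-extendˡ {n} (pos-α {τ} p) with i , q ← Pos-extendˡ p =
  i , subst Pos (cong (node false (mul (α n) τ)) (mul-identityˡ _)) (Pos-mul (Pos-α1 n) q)
Pos-extendˡ {n} (pos-β p) with i , q ← Pos-extendˡ p = suc i , Pos-mul (Pos-ββ n) q

Pos-extendʳ : ∀ {n} {τ : Lab n} → Pos τ → ∃ λ i → Pos (node false (pow (β n) i) τ)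
Pos-extendʳ pos-one = 0 , pos-one
Pos-extendʳ {n} (pos-α {τ} p) with i , q ← Pos-extendʳ p =
  i , subst Pos (cong (λ l → node false l (mul (α n) τ)) (mul-identityˡ _))
        (Pos-mul (Pos-β (suc n)) q)
Pos-extendʳ {n} (pos-β p) with i , q ← Pos-extendʳ p = suc i , Pos-mul (Pos-ββ n) q

degB-pow-β : ∀ n i → degB (pow (β n) i) ≈ + i [ modB n ]
degB-pow-β n zero    = ≈-reflexive (degB-one n)
degB-pow-β n (suc i) =
  ≈-trans (degB-mul (Good-βP n) (Pos⇒Good (Pos-pow i (Pos-β n))))
    (≈-+ (degB-βP n) (degB-pow-β n i))

≈0⇒multiple : ∀ {i m} → + i ≈ + 0 [ m ] → ∃ λ c → i ≡ c ℕ.* m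
≈0⇒multiple {i} {m} (c by eq) = ∣ c ∣ , trans (cong ∣_∣ (trans eq (lemma (c * + m)))) (abs-* c (+ m))
  where
  lemma : ∀ x → + 0 + x ≡ x
  lemma = solve-∀

pow-β-≈0 : ∀ n i → + i ≈ + 0 [ modB n ] → pow (β n) i ≡ one n
pow-β-≈0 n i e with c , refl ← ≈0⇒multiple e = pow-β-modB n c

-- The product (l, β^i)·(β^t, β^t)·(β^j, r) equals (l, r) once β^t cancels both β^i and β^j. Equal
-- β-degrees of `l` and `r` make i and j congruent modulo the order of β, so one `t` serves both.
Pos-node : ∀ {n} {l r : Lab n} → Pos l → Pos r → degB r ≈ degB l [ modB n ] →
           Pos (node false l r)
Pos-node {n} {l} {r} pl pr e
  with i , p ← Pos-extendˡ pl | j , q ← Pos-extendʳ pr | k , eq ← modB-suc n =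
  subst Pos (cong₂ (node false) left right) (Pos-mul p (Pos-mul (Pos-ββ-pow n t) q))
  where
  open ≡-Reasoning
  -- As `modB n` is `suc k`, the sum i + i·k is a multiple of the order of β, so β^t inverts β^i.
  t = i ℕ.* k
  j≈i : + j ≈ + i [ modB n ]
  -- Goodness of the two partial pairs compares the β-degrees of their own halves, linking i to `l`
  -- and j to `r`.
  j≈i with _ , _ , e₁ ← Pos⇒Good p | _ , _ , e₂ ← Pos⇒Good q =
    ≈-trans (≈-sym (degB-pow-β n j)) (≈-trans (≈-+0 (≈-sym e₂))
      (≈-trans e (≈-trans (≈-+0 (≈-sym e₁)) (degB-pow-β n i))))
    where
    ≈-+0 : ∀ {x y m} → x + + 0 ≈ y [ m ] → x ≈ y [ m ]
    ≈-+0 {x} = ≈-trans (≈-reflexive (lemma x))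
      where
      lemma : ∀ x → x ≡ x + + 0
      lemma = solve-∀
  i+t≈0 : + (i ℕ.+ t) ≈ + 0 [ modB n ]
  i+t≈0 = (+ i) by (trans (cong +_ (trans (sym (ℕP.*-suc i k)) (cong (i ℕ.*_) (sym eq))))
    (trans (pos-* i (modB n)) (lemma (+ i * + modB n))))
    where
    lemma : ∀ x → x ≡ + 0 + x
    lemma = solve-∀
  t+j≈0 : + (t ℕ.+ j) ≈ + 0 [ modB n ]
  t+j≈0 = ≈-trans (≈-+ (≈-refl {+ t}) j≈i) (≈-trans (≈-reflexive (cong +_ (ℕP.+-comm t i))) i+t≈0)
  left : mul l (mul (pow (β n) t) (pow (β n) j)) ≡ l
  left = begin
    mul l (mul (pow (β n) t) (pow (β n) j)) ≡⟨ cong (mul l) (pow-+ (β n) t j) ⟨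
    mul l (pow (β n) (t ℕ.+ j))             ≡⟨ cong (mul l) (pow-β-≈0 n _ t+j≈0) ⟩
    mul l (one n)                           ≡⟨ mul-identityʳ l ⟩
    l                                       ∎
  right : mul (pow (β n) i) (mul (pow (β n) t) r) ≡ r
  right = begin
    mul (pow (β n) i) (mul (pow (β n) t) r) ≡⟨ mul-assoc (pow (β n) i) (pow (β n) t) r ⟨
    mul (mul (pow (β n) i) (pow (β n) t)) r ≡⟨ cong (λ z → mul z r) (pow-+ (β n) i t) ⟨
    mul (pow (β n) (i ℕ.+ t)) r             ≡⟨ cong (λ z → mul z r) (pow-β-≈0 n _ i+t≈0) ⟩
    mul (one n) r                           ≡⟨ mul-identityˡ r ⟩
    r                                       ∎

-- Induction on the depth: the sections are positive words by induction, and the root condition is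
-- the degree hypothesis of `Pos-node`.
Good⇒Pos : ∀ {n} {τ : Lab n} → Good τ → Pos τ
Good⇒Pos {τ = leaf} _ = pos-one
Good⇒Pos {suc n} {node false l r} (gl , gr , e) =
  Pos-node (Good⇒Pos gl) (Good⇒Pos gr) (≈-trans e (≈-reflexive (lemma (degB l))))
  where
  lemma : ∀ x → x + + 0 ≡ x
  lemma = solve-∀
Good⇒Pos {suc n} {node true l r} (gl , gr , e) with k , eq ← modB-suc n =
  -- A swap at the root is split off as α·(l, β⁻¹r); the factor β⁻¹ = β^k removes the 1 by which
  -- `degB r` exceeds `degB l`.
  subst Pos (cong₂ (node true) (mul-identityˡ l) right)
    (Pos-mul (Pos-α (suc n)) (Pos-node (Good⇒Pos gl) (Pos-mul (Pos-pow k (Pos-β n)) (Good⇒Pos gr)) e′))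
  where
  open ≡-Reasoning
  right : mul (β n) (mul (pow (β n) k) r) ≡ r
  right = trans (sym (mul-assoc (β n) (pow (β n) k) r))
    (trans (cong (λ z → mul z r) (pow-β-inverseʳ n k eq)) (mul-identityˡ r))
  k+1≈0 : + k + + 1 ≈ + 0 [ modB n ]
  k+1≈0 = (+ 1) by trans (cong +_ (trans (ℕP.+-comm k 1) (sym eq))) (lemma (+ modB n))
    where
    lemma : ∀ x → x ≡ + 0 + + 1 * x
    lemma = solve-∀
  e′ : degB (mul (pow (β n) k) r) ≈ degB l [ modB n ]
  e′ = ≈-trans (degB-mul (Pos⇒Good (Pos-pow k (Pos-β n))) gr)
    (≈-trans (≈-+ (degB-pow-β n k) e)
    (≈-trans (≈-reflexive (lemma (+ k) (degB l)))
    (≈-trans (≈-+ k+1≈0 (≈-refl {degB l})) (≈-reflexive (lemma′ (degB l))))))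
    where
    lemma : ∀ k x → k + (x + + 1) ≡ (k + + 1) + x
    lemma = solve-∀
    lemma′ : ∀ x → + 0 + x ≡ x
    lemma′ = solve-∀

InBn⇔Good : ∀ {n} (τ : Lab n) → InBn n τ ⇔ Good τ
InBn⇔Good τ = mk⇔ InBn⇒Good (λ g → Pos⇒InBn (Good⇒Pos g))

-- Counting extensions

HasCard-⇔ : ∀ {n k} {P Q : Lab n → Set} → (∀ τ → P τ ⇔ Q τ) → HasCard P k → HasCard Q k
HasCard-⇔ P⇔Q (l , u , mem , len) =
  l , u , (λ τ → mk⇔ (λ i → to (P⇔Q τ) (to (mem τ) i)) (λ q → from (mem τ) (from (P⇔Q τ) q))) , len

HasCard-⊎ : ∀ {n j k} {P Q : Lab n → Set} → (∀ τ → P τ → Q τ → ⊥) →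
            HasCard P j → HasCard Q k → HasCard (λ τ → P τ ⊎ Q τ) (j ℕ.+ k)
HasCard-⊎ {P = P} {Q} disjoint (l , u , mem , refl) (l′ , u′ , mem′ , refl) =
  l ++ l′ , ++⁺ u u′ (λ {τ} (i , i′) → disjoint τ (to (mem τ) i) (to (mem′ τ) i′)) ,
  (λ τ → mk⇔ (λ i → case τ (∈-++⁻ l i)) (back τ)) , length-++ l
  where
  case : ∀ τ → τ ∈ l ⊎ τ ∈ l′ → P τ ⊎ Q τ
  case τ (inj₁ i) = inj₁ (to (mem τ) i)
  case τ (inj₂ i) = inj₂ (to (mem′ τ) i)
  back : ∀ τ → P τ ⊎ Q τ → τ ∈ l ++ l′
  back τ (inj₁ p) = ∈-++⁺ˡ (from (mem τ) p)
  back τ (inj₂ q) = ∈-++⁺ʳ l (from (mem′ τ) q)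

length-cartesianProductWith : ∀ {A B C : Set} (f : A → B → C) xs ys →
  length (cartesianProductWith f xs ys) ≡ length xs ℕ.* length ys
length-cartesianProductWith f []       ys = refl
length-cartesianProductWith f (x ∷ xs) ys = trans (length-++ (map (f x) ys))
  (cong₂ ℕ._+_ (length-map (f x) ys) (length-cartesianProductWith f xs ys))

NodeOf : ∀ {n} → Bool → (Lab n → Set) → (Lab n → Set) → Lab (suc n) → Set
NodeOf p P Q (node p′ l r) = p′ ≡ p × P l × Q r

node-injective : ∀ {n p q} {l l′ r r′ : Lab n} →
                 node p l r ≡ node q l′ r′ → p ≡ q × l ≡ l′ × r ≡ r′
node-injective refl = refl , refl , refl

HasCard-node : ∀ {n j k} {P Q : Lab n → Set} p → HasCard P j → HasCard Q k →
               HasCard (NodeOf p P Q) (j ℕ.* k)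
HasCard-node {P = P} {Q} p (l , u , mem , refl) (l′ , u′ , mem′ , refl) =
  cartesianProductWith (node p) l l′ , cartesianProductWith⁺ (node p) (λ e → proj₂ (node-injective e)) u u′ ,
  (λ τ → mk⇔ (fwd τ) (bwd τ)) , length-cartesianProductWith (node p) l l′
  where
  fwd : ∀ τ → τ ∈ cartesianProductWith (node p) l l′ → NodeOf p P Q τ
  fwd τ i with x , y , x∈ , y∈ , refl ← ∈-cartesianProductWith⁻ (node p) l l′ i =
    refl , to (mem x) x∈ , to (mem′ y) y∈
  bwd : ∀ τ → NodeOf p P Q τ → τ ∈ cartesianProductWith (node p) l l′
  bwd (node .p x y) (refl , px , qy) =
    ∈-cartesianProductWith⁺ (node p) (from (mem x) px) (from (mem′ y) qy)

-- Fibres over the distinct entries of the list for `P` are disjoint, so their sizes add. It is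
-- applied to truncation, whose fibres all have the same size.
HasCard-fibres : ∀ {n m j k} {P : Lab n → Set} {F : Lab m → Set} (f : Lab m → Lab n) →
  (∀ τ → P τ → HasCard (λ τ′ → f τ′ ≡ τ × F τ′) k) → HasCard P j →
  HasCard (λ τ′ → P (f τ′) × F τ′) (j ℕ.* k)
HasCard-fibres {m = m} {k = k} {P} {F} f fibre (l , u , mem , refl) =
  HasCard-⇔ (λ τ′ → mk⇔ (λ (i , x) → to (mem _) i , x) (λ (p , x) → from (mem _) p , x))
    (go l u (λ i → to (mem _) i))
  where
  go : ∀ l → Unique l → (∀ {τ} → τ ∈ l → P τ) → HasCard (λ τ′ → f τ′ ∈ l × F τ′) (length l ℕ.* k)
  go []      _         _   = [] , [] , (λ τ → mk⇔ (λ ()) (λ ())) , refl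
  go (τ ∷ l) (τ∉l ∷ u) l⊆P =
    HasCard-⇔ (λ τ′ → mk⇔ join split)
      (HasCard-⊎ (λ { τ′ (refl , _) (i , _) → All.lookup τ∉l i refl })
        (fibre τ (l⊆P (here refl))) (go l u (λ i → l⊆P (there i))))
    where
    join : ∀ {τ′} → (f τ′ ≡ τ × F τ′) ⊎ (f τ′ ∈ l × F τ′) → f τ′ ∈ τ ∷ l × F τ′
    join (inj₁ (e , x)) = here e , x
    join (inj₂ (i , x)) = there i , x
    split : ∀ {τ′} → f τ′ ∈ τ ∷ l × F τ′ → (f τ′ ≡ τ × F τ′) ⊎ (f τ′ ∈ l × F τ′)
    split (here e , x)  = inj₁ (e , x)
    split (there i , x) = inj₂ (i , x)

-- Truncation and the new binary digit of the degree

trunc : ∀ {n} → Lab (suc n) → Lab n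
trunc {zero}  _            = leaf
trunc {suc n} (node p l r) = node p (trunc l) (trunc r)

trunc-restrict : ∀ σ n → trunc (restrict σ (suc n)) ≡ restrict σ n
trunc-restrict σ zero    = refl
trunc-restrict σ (suc n) = cong₂ (node (σ [])) (trunc-restrict _ n) (trunc-restrict _ n)

-- Generation gives this: `τ` is the restriction of a group word, and every restriction of that word
-- is good.
Good-trunc : ∀ {n} (τ : Lab (suc n)) → Good τ → Good (trunc τ)
Good-trunc {n} τ g with w , refl ← from (InBn⇔Good τ) g =
  subst Good (sym (trunc-restrict (eval w) n)) (Good-eval w n)

-- The parity of the depth decides which modulus doubles at the next level; this form of 2k makes
-- the alternation between odd and even depths hold by computation.
double : ℕ → ℕ
double zero    = zero
double (suc k) = suc (suc (double k))

-- The deepest labels change degA (for n even) or degB (for n odd) by topA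
-- or topB times the modulus one level up; the other degree is unaffected.
mutual
  topA : ∀ {n} → Lab (suc n) → Bool
  topA {zero}  (node p _ _) = p
  topA {suc n} (node p l r) = topB l

  topB : ∀ {n} → Lab (suc n) → Bool
  topB {zero}  _            = false
  topB {suc n} (node p l r) = topA l xor topA r

modA≡modB : ∀ k → modA (double k) ≡ modB (double k)
modA≡modB zero    = refl
modA≡modB (suc k) = cong (2 ℕ.*_) (modA≡modB k)

modB-double : ∀ k → modB (double (suc k)) ≡ 2 ℕ.* modB (suc (double k))
modB-double k = cong (2 ℕ.*_) (sym (modA≡modB k))

bit-xor : ∀ m x y → + m * + bit x + + m * + bit y ≈ + m * + bit (x xor y) [ 2 ℕ.* m ]
bit-xor m false y     = ≈-reflexive (lemma (+ m) (+ bit y))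
  where
  lemma : ∀ m y → m * + 0 + m * y ≡ m * y
  lemma = solve-∀
bit-xor m true  false = ≈-reflexive (lemma (+ m))
  where
  lemma : ∀ m → m * + 1 + m * + 0 ≡ m * + 1
  lemma = solve-∀
bit-xor m true  true  = + 1 by trans (lemma (+ m)) (cong (λ z → + m * + 0 + + 1 * z) (sym (pos-* 2 m)))
  where
  lemma : ∀ m → m * + 1 + m * + 1 ≡ m * + 0 + + 1 * (+ 2 * m)
  lemma = solve-∀

mutual
  -- Unfolding alternates between `degB` at odd and `degA` at even depth and ends with `degB` at
  -- depth one, which ignores the label there.
  degB-trunc-even : ∀ k (τ : Lab (suc (double k))) → degB τ ≡ degB (trunc τ)
  degB-trunc-even zero    (node p leaf leaf) = refl
  degB-trunc-even (suc k) (node p l r) = cong₂ _+_ (degA-trunc-odd k l) (degA-trunc-odd k r)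

  degA-trunc-odd : ∀ k (τ : Lab (double (suc k))) → degA τ ≡ degA (trunc τ)
  degA-trunc-odd k (node p l r) = cong (λ z → + bit p + + 2 * z) (degB-trunc-even k l)

mutual
  -- At depth one the α-degree is the new label itself. Going up, `degA` doubles both the new
  -- digit's weight and the modulus, while `degB` adds two digits, whose carry vanishes in the
  -- doubled modulus.
  degA-trunc : ∀ k (τ : Lab (suc (double k))) →
    degA τ ≈ degA (trunc τ) + + modA (double k) * + bit (topA τ) [ 2 ℕ.* modA (double k) ]
  degA-trunc zero (node p leaf leaf) = ≈-reflexive (lemma (+ bit p))
    where
    lemma : ∀ p → p + + 0 ≡ + 0 + + 1 * p
    lemma = solve-∀
  degA-trunc (suc k) (node p l r) =
    ≈-trans (≈-+ (≈-refl {+ bit p}) (≈-double (degB-trunc k l)))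
      (≈-reflexive (trans (lemma (+ bit p) (degB (trunc l)) (+ modB (suc (double k))) (+ bit (topB l)))
        (cong (λ z → (+ bit p + + 2 * degB (trunc l)) + z * + bit (topB l))
          (sym (pos-* 2 (modB (suc (double k))))))))
    where
    lemma : ∀ p x m t → p + + 2 * (x + m * t) ≡ (p + + 2 * x) + (+ 2 * m) * t
    lemma = solve-∀

  degB-trunc : ∀ k (τ : Lab (double (suc k))) →
    degB τ ≈ degB (trunc τ) + + modB (suc (double k)) * + bit (topB τ)
      [ 2 ℕ.* modB (suc (double k)) ]
  degB-trunc k (node p l r) =
    ≈-trans (≈-+ (degA-trunc k l) (degA-trunc k r))
    (≈-trans (≈-reflexive (lemma (degA (trunc l)) (degA (trunc r)) _ _))
      (≈-+ (≈-refl {degA (trunc l) + degA (trunc r)}) (bit-xor (modA (double k)) (topA l) (topA r))))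
    where
    lemma : ∀ x y s t → (x + s) + (y + t) ≡ (x + y) + (s + t)
    lemma = solve-∀

parity-ℕ : ∀ n → ∃₂ λ v d → + n ≡ + bit v + + 2 * d
parity-ℕ zero    = false , + 0 , refl
parity-ℕ (suc n) with parity-ℕ n
... | false , d , e = true , d , trans (cong (λ z → + 1 + z) e) (lemma d)
  where
  lemma : ∀ d → + 1 + (+ 0 + + 2 * d) ≡ + 1 + + 2 * d
  lemma = solve-∀
... | true  , d , e = false , + 1 + d , trans (cong (λ z → + 1 + z) e) (lemma d)
  where
  lemma : ∀ d → + 1 + (+ 1 + + 2 * d) ≡ + 0 + + 2 * (+ 1 + d)
  lemma = solve-∀

parity-ℤ : ∀ i → ∃₂ λ v d → i ≡ + bit v + + 2 * d
parity-ℤ (+ n)    = parity-ℕ n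
parity-ℤ -[1+ n ] with v , d , e ← parity-ℕ (suc n) =
  v , - + bit v + - d , trans (cong -_ e) (lemma (+ bit v) d)
  where
  lemma : ∀ v d → - (v + + 2 * d) ≡ v + + 2 * (- v + - d)
  lemma = solve-∀

odd≢even : ∀ i → + 1 ≡ i * + 2 → ⊥
odd≢even i e = absurd ∣ i ∣ (trans (cong ∣_∣ e) (abs-* i (+ 2)))
  where
  absurd : ∀ k → 1 ≡ k ℕ.* 2 → ⊥
  absurd zero    ()
  absurd (suc k) ()

halfModulus-≉0 : ∀ m → + suc m ≈ + 0 [ 2 ℕ.* suc m ] → ⊥
halfModulus-≉0 m (c by e) = odd≢even c (*-cancelˡ-≡ (+ suc m) (+ 1) (c * + 2)
  (trans (lemma (+ suc m)) (trans e (trans (cong (λ z → + 0 + c * z) (pos-* 2 (suc m))) (lemma′ (+ suc m) c)))))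
  where
  lemma : ∀ m → m * + 1 ≡ m
  lemma = solve-∀
  lemma′ : ∀ m c → + 0 + c * (+ 2 * m) ≡ m * (c * + 2)
  lemma′ = solve-∀

-- After division by `suc m` this is v + y ≡ x modulo 2, checked on all bits.
bits-≈⇔ : ∀ m v x y → + suc m * (+ bit v + + bit y) ≈ + suc m * + bit x [ 2 ℕ.* suc m ] ⇔ y ≡ x xor v
bits-≈⇔ m v x y = mk⇔ (fwd v x y) (λ { refl → bwd v x })
  where
  two : + suc m * + 2 ≈ + suc m * + 0 [ 2 ℕ.* suc m ]
  two = + 1 by trans (lemma (+ suc m)) (cong (λ z → + suc m * + 0 + + 1 * z) (sym (pos-* 2 (suc m))))
    where
    lemma : ∀ m → m * + 2 ≡ m * + 0 + + 1 * (+ 2 * m)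
    lemma = solve-∀
  one≉zero : + suc m * + 1 ≈ + suc m * + 0 [ 2 ℕ.* suc m ] → ⊥
  one≉zero e = halfModulus-≉0 m
    (≈-trans (≈-reflexive (lemma (+ suc m))) (≈-trans e (≈-reflexive (lemma′ (+ suc m)))))
    where
    lemma : ∀ m → m ≡ m * + 1
    lemma = solve-∀
    lemma′ : ∀ m → m * + 0 ≡ + 0
    lemma′ = solve-∀
  fwd : ∀ v x y → + suc m * (+ bit v + + bit y) ≈ + suc m * + bit x [ 2 ℕ.* suc m ] → y ≡ x xor v
  fwd false false false e = refl
  fwd false false true  e = contradiction e one≉zero
  fwd false true  false e = contradiction (≈-sym e) one≉zero
  fwd false true  true  e = refl
  fwd true  false false e = contradiction e one≉zero
  fwd true  false true  e = refl
  fwd true  true  false e = refl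
  fwd true  true  true  e = contradiction (≈-trans (≈-sym e) two) one≉zero
  bwd : ∀ v x → + suc m * (+ bit v + + bit (x xor v)) ≈ + suc m * + bit x [ 2 ℕ.* suc m ]
  bwd false false = ≈-refl
  bwd false true  = ≈-refl
  bwd true  false = two
  bwd true  true  = ≈-refl

-- Lifting the congruence R ≈ L + p from modulus m to 2m is one parity
-- condition on the top bits x, y of the lifts of L, R.
lift-≈ : ∀ {L R p m} → R ≈ L + p [ suc m ] → ∃ λ v → ∀ {L′ R′} x y →
  L′ ≈ L + + suc m * + bit x [ 2 ℕ.* suc m ] → R′ ≈ R + + suc m * + bit y [ 2 ℕ.* suc m ] →
  R′ ≈ L′ + p [ 2 ℕ.* suc m ] ⇔ y ≡ x xor v
-- The bit `v` is the parity of the quotient `c`; the even part of `c` disappears modulo 2m.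
lift-≈ {L} {R} {p} {m} (c by e) with v , d , refl ← parity-ℤ c =
  v , λ {L′} {R′} x y eL eR → mk⇔
    (λ h → to (bits-≈⇔ m v x y) (cancel (L + p)
      (≈-trans (≈-sym (right y eR)) (≈-trans h (left x eL)))))
    (λ h → ≈-trans (right y eR) (≈-trans (≈-+ (≈-refl {L + p}) (from (bits-≈⇔ m v x y) h))
      (≈-sym (left x eL))))
  where
  M = + suc m
  left : ∀ {L′} x → L′ ≈ L + M * + bit x [ 2 ℕ.* suc m ] → L′ + p ≈ (L + p) + M * + bit x [ 2 ℕ.* suc m ]
  left x eL = ≈-trans (≈-+ eL ≈-refl) (≈-reflexive (lemma L p (M * + bit x)))
    where
    lemma : ∀ L p s → (L + s) + p ≡ (L + p) + s
    lemma = solve-∀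
  right : ∀ {R′} y → R′ ≈ R + M * + bit y [ 2 ℕ.* suc m ] →
          R′ ≈ (L + p) + M * (+ bit v + + bit y) [ 2 ℕ.* suc m ]
  right y eR = ≈-trans eR (d by trans (cong (_+ M * + bit y) e)
    (trans (lemma L p (+ bit v) d M (+ bit y))
      (cong (λ z → ((L + p) + M * (+ bit v + + bit y)) + d * z) (sym (pos-* 2 (suc m))))))
    where
    lemma : ∀ L p v d M y → ((L + p) + (v + + 2 * d) * M) + M * y
                          ≡ ((L + p) + M * (v + y)) + d * (+ 2 * M)
    lemma = solve-∀
  cancel : ∀ z {s t N} → z + s ≈ z + t [ N ] → s ≈ t [ N ]
  cancel z {s} {t} h = ≈-trans (≈-reflexive (lemma z s))
    (≈-trans (≈-+ (≈-refl { - z}) h) (≈-reflexive (sym (lemma z t))))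
    where
    lemma : ∀ z s → s ≡ - z + (z + s)
    lemma = solve-∀

-- Extensions with a prescribed new digit

ExtA ExtB : ∀ {n} → Lab n → Bool → Lab (suc n) → Set
ExtA τ u τ′ = trunc τ′ ≡ τ × Good τ′ × topA τ′ ≡ u
ExtB τ u τ′ = trunc τ′ ≡ τ × Good τ′ × topB τ′ ≡ u

mutual
  expA : ℕ → ℕ
  expA zero    = 0
  expA (suc k) = expB k ℕ.+ expB k

  expB : ℕ → ℕ
  expB k = suc (expA k ℕ.+ expA k)

HasCard-2^ : ∀ {n} {P : Lab n → Set} {k} j → HasCard P (2 ^ j ℕ.* 2 ^ k) → HasCard P (2 ^ (j ℕ.+ k))
HasCard-2^ {P = P} {k} j = subst (HasCard P) (sym (ℕP.^-distribˡ-+-* 2 j k))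

HasCard-⊎-2^ : ∀ {n} {P Q : Lab n → Set} {k} → (∀ τ → P τ → Q τ → ⊥) →
               HasCard P (2 ^ k) → HasCard Q (2 ^ k) → HasCard (λ τ → P τ ⊎ Q τ) (2 ^ suc k)
HasCard-⊎-2^ {k = k} disjoint cP cQ =
  subst (HasCard _) (cong (2 ^ k ℕ.+_) (sym (ℕP.+-identityʳ (2 ^ k)))) (HasCard-⊎ disjoint cP cQ)

mutual
  -- Here the modulus of the root condition doubles. The prescribed digit is that of the left
  -- section, and `lift-≈` then forces the digit of the right one, so the count is a single product.
  card-ExtA : ∀ k {τ : Lab (double k)} → Good τ → ∀ u → HasCard (ExtA τ u) (2 ^ expA k)
  card-ExtA zero {leaf} _ u = (node u leaf leaf ∷ []) , ([] ∷ []) ,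
    (λ τ → mk⇔ fwd bwd) , refl
    where
    fwd : ∀ {τ} → τ ∈ (node u leaf leaf ∷ []) → ExtA leaf u τ
    fwd (here refl) = refl , (tt , tt , ((- + bit u) by lemma (+ bit u))) , refl
      where
      lemma : ∀ u → + 0 ≡ (+ 0 + u) + - u * + 1
      lemma = solve-∀
    bwd : ∀ {τ} → ExtA leaf u τ → τ ∈ (node u leaf leaf ∷ [])
    bwd {node p leaf leaf} (_ , _ , refl) = here refl
  card-ExtA (suc k) {node p l r} (gl , gr , e) u with m , eq ← modB-suc (suc (double k))
    with v , cond ← lift-≈ {degB l} {degB r} {+ bit p} {m} (subst (degB r ≈ degB l + + bit p [_]) eq e) =
    HasCard-⇔ (λ τ → mk⇔ fwd bwd)
      (HasCard-2^ (expB k) (HasCard-node p (card-ExtB k gl u) (card-ExtB k gr (u xor v))))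
    where
    lift : ∀ {τ : Lab (suc (double k))} {τ′ : Lab (double (suc k))} → trunc τ′ ≡ τ →
           degB τ′ ≈ degB τ + + suc m * + bit (topB τ′) [ 2 ℕ.* suc m ]
    lift {τ′ = τ′} refl = subst (λ M → degB τ′ ≈ degB (trunc τ′) + + M * + bit (topB τ′) [ 2 ℕ.* M ]) eq (degB-trunc k τ′)
    modulus : modB (double (suc k)) ≡ 2 ℕ.* suc m
    modulus = trans (modB-double k) (cong (2 ℕ.*_) eq)
    fwd : ∀ {τ} → NodeOf p (ExtB l u) (ExtB r (u xor v)) τ → ExtA (node p l r) u τ
    fwd {node .p l′ r′} (refl , (el , gl′ , refl) , (er , gr′ , t)) =
      cong₂ (node p) el er ,
      (gl′ , gr′ , subst (degB r′ ≈ degB l′ + + bit p [_]) (sym modulus)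
        (from (cond (topB l′) (topB r′) (lift {τ′ = l′} el) (lift {τ′ = r′} er)) t)) ,
      refl
    bwd : ∀ {τ} → ExtA (node p l r) u τ → NodeOf p (ExtB l u) (ExtB r (u xor v)) τ
    bwd {node .p l′ r′} (refl , (gl′ , gr′ , e′) , refl) =
      refl , (refl , gl′ , refl) , (refl , gr′ ,
        to (cond (topB l′) (topB r′) (lift {τ′ = l′} refl) (lift {τ′ = r′} refl))
          (subst (degB r′ ≈ degB l′ + + bit p [_]) modulus e′))

  -- Here the sections keep their β-degrees and the modulus stays, so the root condition is
  -- inherited. Only the xor of the two new digits is prescribed; the free choice of the left one
  -- gives the additional factor 2.
  card-ExtB : ∀ k {τ : Lab (suc (double k))} → Good τ → ∀ u → HasCard (ExtB τ u) (2 ^ expB k)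
  card-ExtB k {node p l r} (gl , gr , e) u =
    HasCard-⇔ (λ τ → mk⇔ fwd bwd)
      (HasCard-⊎-2^ {k = expA k ℕ.+ expA k} disjoint (part false) (part true))
    where
    part : ∀ x → HasCard (NodeOf p (ExtA l x) (ExtA r (x xor u))) (2 ^ (expA k ℕ.+ expA k))
    part x = HasCard-2^ (expA k) (HasCard-node p (card-ExtA k gl x) (card-ExtA k gr (x xor u)))
    disjoint : ∀ τ → NodeOf p (ExtA l false) (ExtA r u) τ →
               NodeOf p (ExtA l true) (ExtA r (not u)) τ → ⊥
    disjoint (node _ _ _) (_ , (_ , _ , f) , _) (_ , (_ , _ , t) , _) with () ← trans (sym f) t
    degB-ext : ∀ {τ : Lab (double k)} {τ′ : Lab (suc (double k))} → trunc τ′ ≡ τ → degB τ′ ≡ degB τ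
    degB-ext {τ′ = τ′} refl = degB-trunc-even k τ′
    xor-cancel : ∀ x u → x xor (x xor u) ≡ u
    xor-cancel false u     = refl
    xor-cancel true  false = refl
    xor-cancel true  true  = refl
    fwd′ : ∀ x {τ} → NodeOf p (ExtA l x) (ExtA r (x xor u)) τ → ExtB (node p l r) u τ
    fwd′ x {node .p l′ r′} (refl , (el , gl′ , tl) , (er , gr′ , tr)) =
      cong₂ (node p) el er ,
      (gl′ , gr′ , ≈-trans (≈-reflexive (degB-ext er))
        (≈-trans (subst (degB r ≈ degB l + + bit p [_]) (sym (modA≡modB k)) e)
          (≈-+ (≈-reflexive (sym (degB-ext el))) ≈-refl))) ,
      trans (cong₂ _xor_ tl tr) (xor-cancel x u)
    fwd : ∀ {τ} → NodeOf p (ExtA l false) (ExtA r u) τ ⊎ NodeOf p (ExtA l true) (ExtA r (not u)) τ →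
          ExtB (node p l r) u τ
    fwd (inj₁ x) = fwd′ false x
    fwd (inj₂ x) = fwd′ true x
    bwd : ∀ {τ} → ExtB (node p l r) u τ →
          NodeOf p (ExtA l false) (ExtA r u) τ ⊎ NodeOf p (ExtA l true) (ExtA r (not u)) τ
    bwd {node .p l′ r′} (refl , (gl′ , gr′ , _) , refl) with topA l′
    ... | false = inj₁ (refl , (refl , gl′ , refl) , (refl , gr′ , refl))
    ... | true  = inj₂ (refl , (refl , gl′ , refl) , (refl , gr′ , not-not (topA r′)))
      where
      not-not : ∀ x → x ≡ not (not x)
      not-not false = refl
      not-not true  = refl

-- The exponents e_n and b_n

data Parity : ℕ → Set where
  even : ∀ k → Parity (double k)
  odd  : ∀ k → Parity (suc (double k))

parity : ∀ n → Parity n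
parity zero    = even 0
parity (suc n) with parity n
... | even k = odd k
... | odd k  = even (suc k)

double-%2 : ∀ k → double k % 2 ≡ 0
double-%2 zero    = refl
double-%2 (suc k) = double-%2 k

suc-double-%2 : ∀ k → suc (double k) % 2 ≡ 1
suc-double-%2 zero    = refl
suc-double-%2 (suc k) = suc-double-%2 k

-- The quantity x = `suc (expA k)` obeys x ↦ 4x - 1; adding 3 to the tripled recursion avoids
-- subtraction. The `suc` accounts for the two values of the new digit.
3*suc-expA : ∀ k → 3 ℕ.* suc (expA k) ≡ 2 ℕ.* 2 ^ double k ℕ.+ 1
3*suc-expA zero    = refl
3*suc-expA (suc k) = ℕP.+-cancelʳ-≡ 3 _ _ (begin
  3 ℕ.* suc (expA (suc k)) ℕ.+ 3           ≡⟨ lemma (expA k) ⟩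
  4 ℕ.* (3 ℕ.* suc (expA k))               ≡⟨ cong (4 ℕ.*_) (3*suc-expA k) ⟩
  4 ℕ.* (2 ℕ.* 2 ^ double k ℕ.+ 1)         ≡⟨ lemma′ (2 ^ double k) ⟩
  2 ℕ.* 2 ^ double (suc k) ℕ.+ 1 ℕ.+ 3     ∎)
  where
  open ≡-Reasoning
  lemma : ∀ x → 3 ℕ.* suc (suc (x ℕ.+ x) ℕ.+ suc (x ℕ.+ x)) ℕ.+ 3 ≡ 4 ℕ.* (3 ℕ.* suc x)
  lemma = ℕ-Solver.solve-∀
  lemma′ : ∀ x → 4 ℕ.* (2 ℕ.* x ℕ.+ 1) ≡ 2 ℕ.* (2 ℕ.* (2 ℕ.* x)) ℕ.+ 1 ℕ.+ 3
  lemma′ = ℕ-Solver.solve-∀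

3*suc-expB : ∀ k → 3 ℕ.* suc (expB k) ≡ 2 ℕ.* (2 ℕ.* 2 ^ double k) ℕ.+ 2
3*suc-expB k = begin
  3 ℕ.* suc (expB k)                         ≡⟨ lemma (expA k) ⟩
  2 ℕ.* (3 ℕ.* suc (expA k))                 ≡⟨ cong (2 ℕ.*_) (3*suc-expA k) ⟩
  2 ℕ.* (2 ℕ.* 2 ^ double k ℕ.+ 1)           ≡⟨ lemma′ (2 ^ double k) ⟩
  2 ℕ.* (2 ℕ.* 2 ^ double k) ℕ.+ 2           ∎
  where
  open ≡-Reasoning
  lemma : ∀ x → 3 ℕ.* suc (suc (x ℕ.+ x)) ≡ 2 ℕ.* (3 ℕ.* suc x)
  lemma = ℕ-Solver.solve-∀
  lemma′ : ∀ x → 2 ℕ.* (2 ℕ.* x ℕ.+ 1) ≡ 2 ℕ.* (2 ℕ.* x) ℕ.+ 2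
  lemma′ = ℕ-Solver.solve-∀

k*n/k≡n : ∀ k .{{_ : ℕ.NonZero k}} {m} n → k ℕ.* n ≡ m → m / k ≡ n
k*n/k≡n k n refl = trans (cong (_/ k) (ℕP.*-comm k n)) (m*n/n≡m n k)

eExp-odd : ∀ k → eExp (suc (double k)) ≡ suc (expA k)
eExp-odd k = k*n/k≡n 3 (suc (expA k))
  (trans (3*suc-expA k) (cong (λ z → 2 ^ suc (double k) ℕ.+ (2 ∸ z)) (sym (suc-double-%2 k))))

eExp-even : ∀ k → eExp (double (suc k)) ≡ suc (expB k)
eExp-even k = k*n/k≡n 3 (suc (expB k))
  (trans (3*suc-expB k) (cong (λ z → 2 ^ double (suc k) ℕ.+ (2 ∸ z)) (sym (double-%2 k))))

-- The orders multiply along the truncations down to depth 0, so the exponent of the order of B'_n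
-- is e_1 + ... + e_n.
Σe : ℕ → ℕ
Σe zero    = 0
Σe (suc n) = Σe n ℕ.+ eExp (suc n)

mutual
  6*Σe-even : ∀ k → 6 ℕ.* Σe (double k) ℕ.+ 4 ≡ 4 ℕ.* 2 ^ double k ℕ.+ 3 ℕ.* double k
  6*Σe-even zero    = refl
  -- The added 1 turns the constant 4 into the 5 of the odd case.
  6*Σe-even (suc k) = ℕP.+-cancelʳ-≡ 1 _ _ (begin
    6 ℕ.* (s ℕ.+ eExp (double (suc k))) ℕ.+ 4 ℕ.+ 1
      ≡⟨ cong (λ z → 6 ℕ.* (s ℕ.+ z) ℕ.+ 4 ℕ.+ 1) (eExp-even k) ⟩
    6 ℕ.* (s ℕ.+ suc (expB k)) ℕ.+ 4 ℕ.+ 1     ≡⟨ lemma s (suc (expB k)) ⟩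
    (6 ℕ.* s ℕ.+ 5) ℕ.+ 2 ℕ.* (3 ℕ.* suc (expB k))
      ≡⟨ cong₂ (λ x y → x ℕ.+ 2 ℕ.* y) (6*Σe-odd k) (3*suc-expB k) ⟩
    (8 ℕ.* X ℕ.+ 3 ℕ.* suc (double k)) ℕ.+ 2 ℕ.* (2 ℕ.* (2 ℕ.* X) ℕ.+ 2)
      ≡⟨ lemma′ X (double k) ⟩
    4 ℕ.* 2 ^ double (suc k) ℕ.+ 3 ℕ.* double (suc k) ℕ.+ 1 ∎)
    where
    open ≡-Reasoning
    s = Σe (suc (double k))
    X = 2 ^ double k
    lemma : ∀ s e → 6 ℕ.* (s ℕ.+ e) ℕ.+ 4 ℕ.+ 1 ≡ (6 ℕ.* s ℕ.+ 5) ℕ.+ 2 ℕ.* (3 ℕ.* e)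
    lemma = ℕ-Solver.solve-∀
    lemma′ : ∀ x d → (8 ℕ.* x ℕ.+ 3 ℕ.* suc d) ℕ.+ 2 ℕ.* (2 ℕ.* (2 ℕ.* x) ℕ.+ 2)
                   ≡ 4 ℕ.* (2 ℕ.* (2 ℕ.* x)) ℕ.+ 3 ℕ.* suc (suc d) ℕ.+ 1
    lemma′ = ℕ-Solver.solve-∀

  6*Σe-odd : ∀ k → 6 ℕ.* Σe (suc (double k)) ℕ.+ 5 ≡ 8 ℕ.* 2 ^ double k ℕ.+ 3 ℕ.* suc (double k)
  6*Σe-odd k = begin
    6 ℕ.* (s ℕ.+ eExp (suc (double k))) ℕ.+ 5
      ≡⟨ cong (λ z → 6 ℕ.* (s ℕ.+ z) ℕ.+ 5) (eExp-odd k) ⟩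
    6 ℕ.* (s ℕ.+ suc (expA k)) ℕ.+ 5     ≡⟨ lemma s (suc (expA k)) ⟩
    (6 ℕ.* s ℕ.+ 4) ℕ.+ 2 ℕ.* (3 ℕ.* suc (expA k)) ℕ.+ 1
      ≡⟨ cong₂ (λ x y → x ℕ.+ 2 ℕ.* y ℕ.+ 1) (6*Σe-even k) (3*suc-expA k) ⟩
    (4 ℕ.* X ℕ.+ 3 ℕ.* double k) ℕ.+ 2 ℕ.* (2 ℕ.* X ℕ.+ 1) ℕ.+ 1
      ≡⟨ lemma′ X (double k) ⟩
    8 ℕ.* X ℕ.+ 3 ℕ.* suc (double k) ∎
    where
    open ≡-Reasoning
    s = Σe (double k)
    X = 2 ^ double k
    lemma : ∀ s e → 6 ℕ.* (s ℕ.+ e) ℕ.+ 5 ≡ (6 ℕ.* s ℕ.+ 4) ℕ.+ 2 ℕ.* (3 ℕ.* e) ℕ.+ 1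
    lemma = ℕ-Solver.solve-∀
    lemma′ : ∀ x d → (4 ℕ.* x ℕ.+ 3 ℕ.* d) ℕ.+ 2 ℕ.* (2 ℕ.* x ℕ.+ 1) ℕ.+ 1
                   ≡ 8 ℕ.* x ℕ.+ 3 ℕ.* suc d
    lemma′ = ℕ-Solver.solve-∀

-- The minuend in `bExp` equals 6·`Σe n` plus exactly the subtracted constant, so the subtraction
-- never truncates and the division is exact.
bExp≡Σe : ∀ n → bExp n ≡ Σe n
bExp≡Σe n = k*n/k≡n 6 (Σe n) (begin
  6 ℕ.* Σe n                                        ≡⟨ ℕP.m+n∸n≡m (6 ℕ.* Σe n) (4 ℕ.+ n % 2) ⟨
  6 ℕ.* Σe n ℕ.+ (4 ℕ.+ n % 2) ∸ (4 ℕ.+ n % 2)      ≡⟨ cong (_∸ (4 ℕ.+ n % 2)) (sum (parity n)) ⟩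
  2 ^ (n ℕ.+ 2) ℕ.+ 3 ℕ.* n ∸ (4 ℕ.+ n % 2)         ∎)
  where
  open ≡-Reasoning
  power : ∀ n → 2 ^ (n ℕ.+ 2) ≡ 4 ℕ.* 2 ^ n
  power n = trans (ℕP.^-distribˡ-+-* 2 n 2) (ℕP.*-comm (2 ^ n) 4)
  sum : ∀ {n} → Parity n → 6 ℕ.* Σe n ℕ.+ (4 ℕ.+ n % 2) ≡ 2 ^ (n ℕ.+ 2) ℕ.+ 3 ℕ.* n
  sum (even k) = begin
    6 ℕ.* Σe (double k) ℕ.+ (4 ℕ.+ double k % 2)
      ≡⟨ cong (λ z → 6 ℕ.* Σe (double k) ℕ.+ (4 ℕ.+ z)) (double-%2 k) ⟩
    6 ℕ.* Σe (double k) ℕ.+ 4                       ≡⟨ 6*Σe-even k ⟩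
    4 ℕ.* 2 ^ double k ℕ.+ 3 ℕ.* double k
      ≡⟨ cong (ℕ._+ 3 ℕ.* double k) (power (double k)) ⟨
    2 ^ (double k ℕ.+ 2) ℕ.+ 3 ℕ.* double k         ∎
  sum (odd k) = begin
    6 ℕ.* Σe (suc (double k)) ℕ.+ (4 ℕ.+ suc (double k) % 2)
      ≡⟨ cong (λ z → 6 ℕ.* Σe (suc (double k)) ℕ.+ (4 ℕ.+ z)) (suc-double-%2 k) ⟩
    6 ℕ.* Σe (suc (double k)) ℕ.+ 5                 ≡⟨ 6*Σe-odd k ⟩
    8 ℕ.* 2 ^ double k ℕ.+ 3 ℕ.* suc (double k)
      ≡⟨ cong (ℕ._+ 3 ℕ.* suc (double k)) (trans (ℕP.*-assoc 4 2 (2 ^ double k)) (sym (power (suc (double k))))) ⟩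
    2 ^ (suc (double k) ℕ.+ 2) ℕ.+ 3 ℕ.* suc (double k) ∎

-- Both values of the new digit are equally frequent; the digit is `topA` for even `n` and `topB`
-- for odd `n`.
card-lifts : ∀ n {τ : Lab n} → Good τ → HasCard (λ τ′ → trunc τ′ ≡ τ × Good τ′) (2 ^ eExp (suc n))
card-lifts n = byParity (parity n)
  where
  union : ∀ {n k} {τ : Lab n} (top : Lab (suc n) → Bool) →
    (∀ u → HasCard (λ τ′ → trunc τ′ ≡ τ × Good τ′ × top τ′ ≡ u) (2 ^ k)) →
    HasCard (λ τ′ → trunc τ′ ≡ τ × Good τ′) (2 ^ suc k)
  union {n} {k} {τ} top c = HasCard-⇔ (λ τ′ → mk⇔ fwd bwd)
    (HasCard-⊎-2^ {k = k} (λ { τ′ (_ , _ , f) (_ , _ , t) → absurd (trans (sym f) t) }) (c false) (c true))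
    where
    absurd : false ≡ true → ⊥
    absurd ()
    P : Bool → Lab (suc n) → Set
    P u τ′ = trunc τ′ ≡ τ × Good τ′ × top τ′ ≡ u
    fwd : ∀ {τ′} → P false τ′ ⊎ P true τ′ → trunc τ′ ≡ τ × Good τ′
    fwd (inj₁ (e , g , _)) = e , g
    fwd (inj₂ (e , g , _)) = e , g
    bwd : ∀ {τ′} → trunc τ′ ≡ τ × Good τ′ → P false τ′ ⊎ P true τ′
    bwd {τ′} (e , g) with top τ′ in t
    ... | false = inj₁ (e , g , refl)
    ... | true  = inj₂ (e , g , refl)
  byParity : ∀ {n} → Parity n → {τ : Lab n} → Good τ →
             HasCard (λ τ′ → trunc τ′ ≡ τ × Good τ′) (2 ^ eExp (suc n))
  byParity (even k) {τ} g = subst (λ e → HasCard (λ τ′ → trunc τ′ ≡ τ × Good τ′) (2 ^ e))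
    (sym (eExp-odd k)) (union {k = expA k} topA (card-ExtA k g))
  byParity (odd k) {τ} g = subst (λ e → HasCard (λ τ′ → trunc τ′ ≡ τ × Good τ′) (2 ^ e))
    (sym (eExp-even k)) (union {k = expB k} topB (card-ExtB k g))

card-Good-Σe : ∀ n → HasCard {n} Good (2 ^ Σe n)
card-Good-Σe zero    = (leaf ∷ []) , ([] ∷ []) , (λ { leaf → mk⇔ (λ _ → tt) (λ _ → here refl) }) , refl
card-Good-Σe (suc n) = HasCard-2^ (Σe n)
  (HasCard-⇔ (λ τ → mk⇔ proj₂ (λ g → Good-trunc τ g , g))
    (HasCard-fibres trunc (λ τ g → card-lifts n g) (card-Good-Σe n)))

card-Good : ∀ n → HasCard {n} Good (2 ^ bExp n)
card-Good n = subst (λ e → HasCard {n} Good (2 ^ e)) (sym (bExp≡Σe n)) (card-Good-Σe n)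

-- Degrees and the functions Q and P

≡mod⇔≈ : ∀ {x y} k → x ≡ y [mod2^ k ] ⇔ x ≈ y [ 2 ^ k ]
≡mod⇔≈ {x} {y} k = mk⇔ fwd bwd
  where
  fwd : x ≡ y [mod2^ k ] → x ≈ y [ 2 ^ k ]
  fwd d with divides q eq ← ∣ᵤ⇒∣ {+ (2 ^ k)} {x - y} d = q by trans (lemma x y) (cong (λ z → y + z) eq)
    where
    lemma : ∀ x y → x ≡ y + (x - y)
    lemma = solve-∀
  bwd : x ≈ y [ 2 ^ k ] → x ≡ y [mod2^ k ]
  bwd (c by eq) = ∣⇒∣ᵤ {+ (2 ^ k)} {x - y} (divides c (trans (cong (_- y) eq) (lemma y (c * + (2 ^ k)))))
    where
    lemma : ∀ y z → (y + z) - y ≡ z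
    lemma = solve-∀

≈-mod-1 : ∀ {x y} → x ≈ y [ 1 ]
≈-mod-1 {x} {y} = (x - y) by lemma x y
  where
  lemma : ∀ x y → x ≡ y + (x - y) * + 1
  lemma = solve-∀

≈-weaken : ∀ {x y m} → x ≈ y [ 2 ℕ.* m ] → x ≈ y [ m ]
≈-weaken {x} {y} {m} (c by eq) = (c * + 2) by
  trans eq (trans (cong (λ z → y + c * z) (pos-* 2 m)) (lemma y c (+ m)))
  where
  lemma : ∀ y c m → y + c * (+ 2 * m) ≡ y + (c * + 2) * m
  lemma = solve-∀

≈-2^-≤ : ∀ {x y j k} → j ≤ k → x ≈ y [ 2 ^ k ] → x ≈ y [ 2 ^ j ]
≈-2^-≤ {x} {y} {j} {k} j≤k e = go (k ∸ j) (subst (λ k → x ≈ y [ 2 ^ k ]) (sym (ℕP.m∸n+n≡m j≤k)) e)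
  where
  go : ∀ d → x ≈ y [ 2 ^ (d ℕ.+ j) ] → x ≈ y [ 2 ^ j ]
  go zero    e = e
  go (suc d) e = go d (≈-weaken e)

section : Aut∞ → Bool → Aut∞
section σ c v = σ (c ∷ v)

S-∷ : ∀ σ c x i → S σ (c ∷ x) i ≡ S (section σ c) x i
S-∷ σ c x zero    = refl
S-∷ σ c x (suc i) = cong₂ ℕ._+_ (S-∷ σ c (x ++ false ∷ false ∷ []) i) (S-∷ σ c (x ++ false ∷ true ∷ []) i)

Qt-∷ : ∀ σ c x k → Qt σ (c ∷ x) k ≡ Qt (section σ c) x k
Qt-∷ σ c x zero    = refl
Qt-∷ σ c x (suc k) = cong₂ (λ q s → q ℕ.+ 2 ^ k ℕ.* s) (Qt-∷ σ c x k) (S-∷ σ c x k)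

Pt-∷ : ∀ σ c x k → Pt σ (c ∷ x) k ≡ Pt (section σ c) x k
Pt-∷ σ c x k = cong₂ (λ u v → (sgn (σ (c ∷ x)) + (+ 2) * + u) - (+ 2) * + v)
  (cong₂ ℕ._+_ (Qt-∷ σ c (x ++ true ∷ false ∷ []) k) (Qt-∷ σ c (x ++ true ∷ true ∷ []) k))
  (cong₂ ℕ._+_ (Qt-∷ σ c (x ++ false ∷ false ∷ []) k) (Qt-∷ σ c (x ++ false ∷ true ∷ []) k))

-- `Qt` grows by its last term, whereas the degrees unfold from the root; peeling off the first term
-- gives Q the recursion of `degA`.
Qt-suc : ∀ σ x k → Qt σ x (suc k) ≡
  bit (σ x) ℕ.+ 2 ℕ.* (Qt σ (x ++ false ∷ false ∷ []) k ℕ.+ Qt σ (x ++ false ∷ true ∷ []) k)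
Qt-suc σ x zero    = lemma (bit (σ x))
  where
  lemma : ∀ p → 0 ℕ.+ 1 ℕ.* p ≡ p ℕ.+ 2 ℕ.* (0 ℕ.+ 0)
  lemma = ℕ-Solver.solve-∀
Qt-suc σ x (suc k) = trans (cong (ℕ._+ 2 ^ suc k ℕ.* S σ x (suc k)) (Qt-suc σ x k))
  (lemma (bit (σ x)) (Qt σ (x ++ false ∷ false ∷ []) k) (Qt σ (x ++ false ∷ true ∷ []) k) (2 ^ k)
    (S σ (x ++ false ∷ false ∷ []) k) (S σ (x ++ false ∷ true ∷ []) k))
  where
  lemma : ∀ p u v m s t → (p ℕ.+ 2 ℕ.* (u ℕ.+ v)) ℕ.+ (2 ℕ.* m) ℕ.* (s ℕ.+ t)
                        ≡ p ℕ.+ 2 ℕ.* ((u ℕ.+ m ℕ.* s) ℕ.+ (v ℕ.+ m ℕ.* t))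
  lemma = ℕ-Solver.solve-∀

mutual
  -- Two steps of the degree recursion, into the left child and then into both of its children, are
  -- one step of `Qt-suc`. Hence two levels contribute one term of the series, and the equality is
  -- exact.
  degA-restrict : ∀ σ n → degA (restrict σ n) ≡ + Qt σ [] ⌈ n /2⌉
  degA-restrict σ zero    = refl
  degA-restrict σ (suc n) = begin
    + bit (σ []) + + 2 * degB (restrict (section σ false) n)
      ≡⟨ cong (λ z → + bit (σ []) + + 2 * z) (degB-restrict (section σ false) n) ⟩
    + bit (σ []) + + 2 * + (Qt (section σ false) (false ∷ []) h ℕ.+ Qt (section σ false) (true ∷ []) h)
      ≡⟨ cong (λ z → + bit (σ []) + + 2 * + z) (cong₂ ℕ._+_ (Qt-∷ σ false _ h) (Qt-∷ σ false _ h)) ⟨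
    + bit (σ []) + + 2 * + Q
      ≡⟨ cong (λ z → + bit (σ []) + z) (pos-* 2 Q) ⟨
    + (bit (σ []) ℕ.+ 2 ℕ.* Q)
      ≡⟨ cong +_ (Qt-suc σ [] h) ⟨
    + Qt σ [] (suc h) ∎
    where
    open ≡-Reasoning
    h = ⌊ n /2⌋
    Q = Qt σ (false ∷ false ∷ []) h ℕ.+ Qt σ (false ∷ true ∷ []) h

  degB-restrict : ∀ σ n → degB (restrict σ n) ≡ + (Qt σ (false ∷ []) ⌊ n /2⌋ ℕ.+ Qt σ (true ∷ []) ⌊ n /2⌋)
  degB-restrict σ zero    = refl
  degB-restrict σ (suc n) = trans
    (cong₂ _+_ (degA-restrict (section σ false) n) (degA-restrict (section σ true) n))
    (sym (cong +_ (cong₂ ℕ._+_ (Qt-∷ σ false [] ⌈ n /2⌉) (Qt-∷ σ true [] ⌈ n /2⌉))))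

mutual
  modA≡2^ : ∀ n → modA n ≡ 2 ^ ⌈ n /2⌉
  modA≡2^ zero    = refl
  modA≡2^ (suc n) = cong (2 ℕ.*_) (modB≡2^ n)

  modB≡2^ : ∀ n → modB n ≡ 2 ^ ⌊ n /2⌋
  modB≡2^ zero    = refl
  modB≡2^ (suc n) = modA≡2^ n

-- Each Q changes by a multiple of 2^k and enters P with a factor 2. Thus `Pt σ x k` already
-- determines P modulo 2^(k+1), one digit more than its index.
Pt-suc : ∀ σ x k → Pt σ x (suc k) ≈ Pt σ x k [ 2 ^ suc k ]
Pt-suc σ x k = ((+ s₁ + + s₂) - (+ s₃ + + s₄)) by (begin
  (sgn (σ x) + + 2 * + (q₁ ℕ.+ m ℕ.* s₁ ℕ.+ (q₂ ℕ.+ m ℕ.* s₂))) - + 2 * + (q₃ ℕ.+ m ℕ.* s₃ ℕ.+ (q₄ ℕ.+ m ℕ.* s₄))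
    ≡⟨ cong₂ (λ u v → (sgn (σ x) + + 2 * u) - + 2 * v) (cast q₁ s₁ q₂ s₂) (cast q₃ s₃ q₄ s₄) ⟩
  (sgn (σ x) + + 2 * (+ q₁ + + m * + s₁ + (+ q₂ + + m * + s₂))) - + 2 * (+ q₃ + + m * + s₃ + (+ q₄ + + m * + s₄))
    ≡⟨ lemma (sgn (σ x)) (+ q₁) (+ q₂) (+ q₃) (+ q₄) (+ s₁) (+ s₂) (+ s₃) (+ s₄) (+ m) ⟩
  Pt σ x k + ((+ s₁ + + s₂) - (+ s₃ + + s₄)) * (+ 2 * + m)
    ≡⟨ cong (λ z → Pt σ x k + ((+ s₁ + + s₂) - (+ s₃ + + s₄)) * z) (pos-* 2 m) ⟨
  Pt σ x k + ((+ s₁ + + s₂) - (+ s₃ + + s₄)) * + (2 ^ suc k) ∎)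
  where
  open ≡-Reasoning
  m  = 2 ^ k
  q₁ = Qt σ (x ++ true ∷ false ∷ []) k
  q₂ = Qt σ (x ++ true ∷ true ∷ []) k
  q₃ = Qt σ (x ++ false ∷ false ∷ []) k
  q₄ = Qt σ (x ++ false ∷ true ∷ []) k
  s₁ = S σ (x ++ true ∷ false ∷ []) k
  s₂ = S σ (x ++ true ∷ true ∷ []) k
  s₃ = S σ (x ++ false ∷ false ∷ []) k
  s₄ = S σ (x ++ false ∷ true ∷ []) k
  cast : ∀ q s q′ s′ → + (q ℕ.+ m ℕ.* s ℕ.+ (q′ ℕ.+ m ℕ.* s′)) ≡ + q + + m * + s + (+ q′ + + m * + s′)
  cast q s q′ s′ = cong₂ (λ u v → + q + u + (+ q′ + v)) (pos-* m s) (pos-* m s′)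
  lemma : ∀ z q₁ q₂ q₃ q₄ s₁ s₂ s₃ s₄ m →
    (z + + 2 * (q₁ + m * s₁ + (q₂ + m * s₂))) - + 2 * (q₃ + m * s₃ + (q₄ + m * s₄))
    ≡ ((z + + 2 * (q₁ + q₂)) - + 2 * (q₃ + q₄)) + ((s₁ + s₂) - (s₃ + s₄)) * (+ 2 * m)
  lemma = solve-∀

Pt-≤ : ∀ σ x {j k} → j ≤ k → Pt σ x k ≈ Pt σ x j [ 2 ^ j ]
Pt-≤ σ x {j} {k} j≤k = subst (λ k → Pt σ x k ≈ Pt σ x j [ 2 ^ j ]) (ℕP.m∸n+n≡m j≤k) (go (k ∸ j))
  where
  go : ∀ d → Pt σ x (d ℕ.+ j) ≈ Pt σ x j [ 2 ^ j ]
  go zero    = ≈-refl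
  go (suc d) = ≈-trans (≈-2^-≤ (ℕP.m≤n+m j (suc d)) (Pt-suc σ x (d ℕ.+ j))) (go d)

sgn≡1-2bit : ∀ p → sgn p ≡ + 1 - + 2 * + bit p
sgn≡1-2bit false = refl
sgn≡1-2bit true  = refl

-- With (-1)^p = 1 - 2p, the left side minus 1 is 2(R - L - p), and cancelling 2 halves the modulus.
sgn+2Δ≈1⇔ : ∀ {L R m} p → ((sgn p + + 2 * R) - + 2 * L) ≈ + 1 [ 2 ℕ.* m ] ⇔ R ≈ L + + bit p [ m ]
sgn+2Δ≈1⇔ {L} {R} {m} p = mk⇔ fwd bwd
  where
  open ≡-Reasoning
  P = + bit p
  lemma : ∀ P L R → + 2 * R ≡ ((((+ 1 - + 2 * P) + + 2 * R) - + 2 * L) - + 1) + + 2 * (L + P)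
  lemma = solve-∀
  lemma′ : ∀ P L c m → ((+ 1 + c * (+ 2 * m)) - + 1) + + 2 * (L + P) ≡ + 2 * ((L + P) + c * m)
  lemma′ = solve-∀
  lemma″ : ∀ P L c m → ((+ 1 - + 2 * P) + + 2 * ((L + P) + c * m)) - + 2 * L ≡ + 1 + c * (+ 2 * m)
  lemma″ = solve-∀
  fwd : ((sgn p + + 2 * R) - + 2 * L) ≈ + 1 [ 2 ℕ.* m ] → R ≈ L + P [ m ]
  fwd (c by eq) = c by *-cancelˡ-≡ (+ 2) R ((L + P) + c * + m) (begin
    + 2 * R
      ≡⟨ lemma P L R ⟩
    ((((+ 1 - + 2 * P) + + 2 * R) - + 2 * L) - + 1) + + 2 * (L + P)
      ≡⟨ cong (λ z → (((z + + 2 * R) - + 2 * L) - + 1) + + 2 * (L + P)) (sgn≡1-2bit p) ⟨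
    (((sgn p + + 2 * R) - + 2 * L) - + 1) + + 2 * (L + P)
      ≡⟨ cong (λ z → (z - + 1) + + 2 * (L + P)) (trans eq (cong (λ z → + 1 + c * z) (pos-* 2 m))) ⟩
    ((+ 1 + c * (+ 2 * + m)) - + 1) + + 2 * (L + P)
      ≡⟨ lemma′ P L c (+ m) ⟩
    + 2 * ((L + P) + c * + m) ∎)
  bwd : R ≈ L + P [ m ] → ((sgn p + + 2 * R) - + 2 * L) ≈ + 1 [ 2 ℕ.* m ]
  bwd (c by refl) = c by
    trans (cong (λ z → (z + + 2 * ((L + P) + c * + m)) - + 2 * L) (sgn≡1-2bit p))
      (trans (lemma″ P L c (+ m)) (cong (λ z → + 1 + c * z) (sym (pos-* 2 m))))

-- By `Pt-suc` the index may be lowered to ⌊n/2⌋ at no loss of modulus, and there the sums of `Qt`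
-- are exactly the β-degrees of the two sections.
Pt-root⇔ : ∀ σ n → Pt σ [] (suc ⌊ n /2⌋) ≈ + 1 [ 2 ^ suc ⌊ n /2⌋ ] ⇔
  degB (restrict (section σ true) n) ≈ degB (restrict (section σ false) n) + + bit (σ []) [ modB n ]
Pt-root⇔ σ n = mk⇔
  (λ e → subst (R ≈ L + + bit (σ []) [_]) (sym (modB≡2^ n))
    (to (sgn+2Δ≈1⇔ (σ [])) (≈-trans (≈-sym step) e)))
  (λ e → ≈-trans step (from (sgn+2Δ≈1⇔ (σ [])) (subst (R ≈ L + + bit (σ []) [_]) (modB≡2^ n) e)))
  where
  h = ⌊ n /2⌋
  L = degB (restrict (section σ false) n)
  R = degB (restrict (section σ true) n)
  deg : ∀ c → + (Qt σ (c ∷ false ∷ []) h ℕ.+ Qt σ (c ∷ true ∷ []) h) ≡ degB (restrict (section σ c) n)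
  deg c = trans (cong +_ (cong₂ ℕ._+_ (Qt-∷ σ c (false ∷ []) h) (Qt-∷ σ c (true ∷ []) h)))
    (sym (degB-restrict (section σ c) n))
  step : Pt σ [] (suc h) ≈ (sgn (σ []) + + 2 * R) - + 2 * L [ 2 ^ suc h ]
  step = ≈-trans (Pt-suc σ [] h)
    (≈-reflexive (cong₂ (λ u v → (sgn (σ []) + + 2 * u) - + 2 * v) (deg true) (deg false)))

/2≡⌊/2⌋ : ∀ n → n / 2 ≡ ⌊ n /2⌋
/2≡⌊/2⌋ zero          = refl
/2≡⌊/2⌋ (suc zero)    = refl
/2≡⌊/2⌋ (suc (suc n)) = trans (+-distrib-/-∣ˡ n {2} ∣-refl) (cong suc (/2≡⌊/2⌋ n))

prec-suc-0 : ∀ n → prec (suc n) 0 ≡ suc ⌊ n /2⌋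
prec-suc-0 n = trans (/2≡⌊/2⌋ (suc n ℕ.+ 1)) (cong ⌊_/2⌋ (ℕP.+-comm (suc n) 1))

-- Goodness as membership in B'_n, the kernel of P, the closure and E_n

P≈1 : Aut∞ → ℕ → Set
P≈1 σ n = ∀ x → length x ≤ n → Pt σ x (prec n (length x)) ≈ + 1 [ 2 ^ prec n (length x) ]

-- The precision at `x` depends only on n - |x|, the depth of the tree below `x`, so the condition
-- passes to the sections and leaves `Pt-root⇔` at the root.
P≈1⇔Good : ∀ σ n → P≈1 σ n ⇔ Good (restrict σ n)
P≈1⇔Good σ n = mk⇔ (fwd σ n) (bwd σ n)
  where
  Root : Aut∞ → ℕ → Set
  Root σ k = Pt σ [] k ≈ + 1 [ 2 ^ k ]
  fwd : ∀ σ n → P≈1 σ n → Good (restrict σ n)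
  fwd σ zero    h = tt
  fwd σ (suc n) h = below false , below true , to (Pt-root⇔ σ n) (subst (Root σ) (prec-suc-0 n) (h [] z≤n))
    where
    below : ∀ c → Good (restrict (section σ c) n)
    below c = fwd (section σ c) n λ x ≤n →
      subst (_≈ + 1 [ 2 ^ prec n (length x) ]) (Pt-∷ σ c x (prec n (length x))) (h (c ∷ x) (s≤s ≤n))
  bwd : ∀ σ n → Good (restrict σ n) → P≈1 σ n
  -- At the bottom level the precision is 0 and the modulus is 1.
  bwd σ zero    _             []          _        = ≈-mod-1
  bwd σ (suc n) (gl , gr , e) []          _        =
    subst (Root σ) (sym (prec-suc-0 n)) (from (Pt-root⇔ σ n) e)
  bwd σ (suc n) (gl , gr , e) (false ∷ x) (s≤s ≤n) =
    subst (_≈ + 1 [ 2 ^ prec n (length x) ]) (sym (Pt-∷ σ false x (prec n (length x)))) (bwd (section σ false) n gl x ≤n)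
  bwd σ (suc n) (gl , gr , e) (true ∷ x)  (s≤s ≤n) =
    subst (_≈ + 1 [ 2 ^ prec n (length x) ]) (sym (Pt-∷ σ true x (prec n (length x)))) (bwd (section σ true) n gr x ≤n)

restrict-ext : ∀ {n} (τ : Lab n) → restrict (ext τ) n ≡ τ
restrict-ext leaf         = refl
restrict-ext (node p l r) = cong₂ (node p) (restrict-ext l) (restrict-ext r)

-- The root has the highest precision, so P ≡ 1 there reduces to every `prec n m`, and agreement
-- with the root becomes P ≡ 1 at each node.
InB'n⇔Good : ∀ {n} (τ : Lab n) → InB'n n τ ⇔ Good τ
InB'n⇔Good {n} τ = mk⇔
  (λ h → subst Good (restrict-ext τ) (to (P≈1⇔Good (ext τ) n) (fwd h)))
  (λ g → bwd (from (P≈1⇔Good (ext τ) n) (subst Good (sym (restrict-ext τ)) g)))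
  where
  σ = ext τ
  prec≤ : ∀ m → prec n m ≤ prec n 0
  prec≤ m = /-monoˡ-≤ 2 (ℕP.m∸n≤m (n ℕ.+ 1) m)
  root : Pt σ [] (prec n 0) ≈ + 1 [ 2 ^ prec n 0 ] → ∀ m → Pt σ [] (prec n m) ≈ + 1 [ 2 ^ prec n m ]
  root e m = ≈-trans (≈-sym (Pt-≤ σ [] (prec≤ m))) (≈-2^-≤ (prec≤ m) e)
  fwd : InB'n n τ → P≈1 σ n
  fwd (m , e) x ≤n = ≈-trans (to (≡mod⇔≈ (prec n (length x))) (m x ≤n))
    (root (to (≡mod⇔≈ (prec n 0)) e) (length x))
  bwd : P≈1 σ n → InB'n n τ
  bwd h = (λ x ≤n → from (≡mod⇔≈ (prec n (length x))) (≈-trans (h x ≤n) (≈-sym (root (h [] z≤n) (length x))))) ,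
    from (≡mod⇔≈ (prec n 0)) (h [] z≤n)

-- Congruences modulo all 2^k at all nodes are exhausted by the finite levels.
InKerP⇔Good : ∀ σ → InKerP σ ⇔ (∀ n → Good (restrict σ n))
InKerP⇔Good σ = mk⇔ fwd bwd
  where
  fwd : InKerP σ → ∀ n → Good (restrict σ n)
  fwd (m , e) n = to (P≈1⇔Good σ n) λ x _ →
    let k = prec n (length x) in ≈-trans (to (≡mod⇔≈ k) (m x k)) (to (≡mod⇔≈ k) (e k))
  prec-length+double : ∀ m k → prec (m ℕ.+ double k) m ≡ k
  prec-length+double m k = begin
    (m ℕ.+ double k ℕ.+ 1 ∸ m) / 2 ≡⟨ cong (λ z → (z ∸ m) / 2) (ℕP.+-assoc m (double k) 1) ⟩
    (m ℕ.+ (double k ℕ.+ 1) ∸ m) / 2 ≡⟨ cong (_/ 2) (ℕP.m+n∸m≡n m (double k ℕ.+ 1)) ⟩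
    (double k ℕ.+ 1) / 2 ≡⟨ /2≡⌊/2⌋ (double k ℕ.+ 1) ⟩
    ⌊ double k ℕ.+ 1 /2⌋ ≡⟨ half k ⟩
    k ∎
    where
    open ≡-Reasoning
    half : ∀ k → ⌊ double k ℕ.+ 1 /2⌋ ≡ k
    half zero    = refl
    half (suc k) = cong suc (half k)
  bwd : (∀ n → Good (restrict σ n)) → InKerP σ
  bwd g = (λ x k → from (≡mod⇔≈ k) (≈-trans (P≈1-at x k) (≈-sym (P≈1-at [] k)))) ,
          (λ k → from (≡mod⇔≈ k) (P≈1-at [] k))
    where
    P≈1-at : ∀ x k → Pt σ x k ≈ + 1 [ 2 ^ k ]
    P≈1-at x k = subst (λ k → Pt σ x k ≈ + 1 [ 2 ^ k ]) (prec-length+double (length x) k)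
      (from (P≈1⇔Good σ n) (g n) x (ℕP.m≤m+n (length x) (double k)))
      where
      -- At this depth the precision at `x` is exactly `k`.
      n = length x ℕ.+ double k

act≡⇔restrict≡ : ∀ σ τ n → (∀ x → length x ≤ n → act σ x ≡ act τ x) ⇔ restrict σ n ≡ restrict τ n
act≡⇔restrict≡ σ τ n = mk⇔ (fwd σ τ n) (bwd σ τ n)
  where
  fwd : ∀ σ τ n → (∀ x → length x ≤ n → act σ x ≡ act τ x) → restrict σ n ≡ restrict τ n
  fwd σ τ zero    h = refl
  fwd σ τ (suc n) h = trans
    (cong (λ p → node p _ _) (∷-injectiveˡ (h (false ∷ []) (s≤s z≤n))))
    (cong₂ (node (τ [])) (below false) (below true))
    where
    below : ∀ c → restrict (section σ c) n ≡ restrict (section τ c) n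
    below c = fwd (section σ c) (section τ c) n (λ x ≤n → ∷-injectiveʳ (h (c ∷ x) (s≤s ≤n)))
  bwd : ∀ σ τ n → restrict σ n ≡ restrict τ n → ∀ x → length x ≤ n → act σ x ≡ act τ x
  bwd σ τ n       e []          _        = refl
  bwd σ τ (suc n) e (false ∷ x) (s≤s ≤n) with p , l , r ← node-injective e =
    cong₂ _∷_ p (bwd (section σ false) (section τ false) n l x ≤n)
  bwd σ τ (suc n) e (true ∷ x)  (s≤s ≤n) with p , l , r ← node-injective e =
    cong₂ _∷_ (cong not p) (bwd (section σ true) (section τ true) n r x ≤n)

-- Approximation of σ at level `n` says that its restriction lies in B_n; the approximating word may
-- change with `n`.
InClosureB⇔Good : ∀ σ → InClosureB σ ⇔ (∀ n → Good (restrict σ n))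
InClosureB⇔Good σ = mk⇔ fwd bwd
  where
  fwd : InClosureB σ → ∀ n → Good (restrict σ n)
  fwd h n with w , agree ← h n =
    InBn⇒Good (w , to (act≡⇔restrict≡ (eval w) σ n) agree)
  bwd : (∀ n → Good (restrict σ n)) → InClosureB σ
  bwd g n with w , eq ← from (InBn⇔Good (restrict σ n)) (g n) =
    w , from (act≡⇔restrict≡ (eval w) σ n) eq

act-idA : ∀ x → act idA x ≡ x
act-idA []      = refl
act-idA (c ∷ x) = cong₂ _∷_ (xor-identityʳ c) (act-idA x)

-- Fixing all nodes of length at most `n` means trivial labels above the last level, so E_(n+1) is
-- the fibre of truncation over the identity, counted by `card-lifts`.
InEn⇔Good : ∀ {n} (τ : Lab (suc n)) → InEn (suc n) τ ⇔ (trunc τ ≡ one n × Good τ)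
InEn⇔Good {n} τ = mk⇔
  (λ (b , fix) → trans trunc≡ (to agree (λ x ≤n → trans (fix x ≤n) (sym (act-idA x)))) ,
                 to (InB'n⇔Good τ) b)
  (λ (e , g) → from (InB'n⇔Good τ) g ,
               λ x ≤n → trans (from agree (trans (sym trunc≡) e) x ≤n) (act-idA x))
  where
  agree = act≡⇔restrict≡ (ext τ) idA n
  trunc≡ : trunc τ ≡ restrict (ext τ) n
  trunc≡ = trans (cong trunc (sym (restrict-ext τ))) (trunc-restrict (ext τ) n)

theorem4p5 : (∀ (n : ℕ) → 1 ≤ n →
    HasCard (InEn n) (2 ^ eExp n)
    × HasCard (InBn n) (2 ^ bExp n)
    × HasCard (InB'n n) (2 ^ bExp n)
    × (∀ τ → InBn n τ ⇔ InB'n n τ))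
    × (∀ (σ : Aut∞) → InClosureB σ ⇔ InKerP σ)
theorem4p5 = finite , λ σ → ⇔-trans (InClosureB⇔Good σ) (⇔-sym (InKerP⇔Good σ))
  where
  finite : ∀ (n : ℕ) → 1 ≤ n →
    HasCard (InEn n) (2 ^ eExp n)
    × HasCard (InBn n) (2 ^ bExp n)
    × HasCard (InB'n n) (2 ^ bExp n)
    × (∀ τ → InBn n τ ⇔ InB'n n τ)
  finite (suc n) _ =
    HasCard-⇔ (λ τ → ⇔-sym (InEn⇔Good τ)) (card-lifts n (Good-one n)) ,
    HasCard-⇔ (λ τ → ⇔-sym (InBn⇔Good τ)) (card-Good (suc n)) ,
    HasCard-⇔ (λ τ → ⇔-sym (InB'n⇔Good τ)) (card-Good (suc n)) ,
    λ τ → ⇔-trans (InBn⇔Good τ) (⇔-sym (InB'n⇔Good τ))
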